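{- The Heawood graph and the Pappus graph are the only irreducible Levi graphs which are pseudo $2$-factor isomorphic. That is, for every finite simple graph $G$, the following are equivalent: (i) $G$ is an irreducible Levi graph (i.e. $G$ is isomorphic to the Levi graph of a connected irreducible symmetric configuration $n_3$ for some $n$) and $G$ is pseudo $2$-factor isomorphic; (ii) $G$ is isomorphic to the Heawood graph $H_0$ or to the Pappus graph $P_0$.
   Context: All graphs are finite and simple. A $2$-factor of a graph is a $2$-regular spanning subgraph, i.e. a spanning subgraph that is a disjoint union of circuits. A graph is pseudo $2$-factor isomorphic if the parity of the number of circuits in a $2$-factor is the same for all of its $2$-factors. An incidence structure is linear if any two different points are incident with at most one common line. A symmetric configuration $n_3$ is a linear incidence structure with $n$ points and $n$ lines such that each point is incident with exactly $3$ lines and each line with exactly $3$ points. Its Levi graph (incidence graph) is the cubic bipartite graph whose vertices are the points and the lines, a point and a line being adjacent iff they are incident. A configuration is connected if its Levi graph is connected. Martinetti extension: let $\mathcal C$ be a symmetric configuration $(n-1)_3$ with two non-intersecting lines $\{\alpha,\alpha_1,\alpha_2\}$ and $\{\beta,\beta_1,\beta_2\}$ such that the points $\alpha,\beta$ are not on a common line. Delete these two lines, add a new point $\mu$, and add the lines $\{\mu,\alpha_1,\alpha_2\}$, $\{\mu,\beta_1,\beta_2\}$, $\{\mu,\alpha,\beta\}$; the result is a symmetric configuration $n_3$. A symmetric configuration $n_3$ is irreducible if it cannot be obtained in this way from any symmetric configuration $(n-1)_3$. An irreducible Levi graph is the Levi graph of a connected irreducible symmetric configuration $n_3$. Known description of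 the irreducible Levi graphs (a theorem of Boben, completing Martinetti's list, which may be taken as given): up to isomorphism they are exactly the following graphs. (1) $D(n)$, $n\ge 7$: the Levi graph of the cyclic configuration with base line $\{0,1,3\}$, i.e. with point set $\mathbb Z_n$ and lines $\{i,i+1,i+3\}$, $i\in\mathbb Z_n$. (2) $T_1(n),T_2(n),T_3(n)$, $n\ge1$, defined as follows. The segment $G_T$ with index $i$ has the $20$ vertices $u_i^j,w_i^j,x_i^j,y_i^j,z_i^j,v_i^j$ ($j=1,2,3$), $t_i^1,t_i^2$, and (omitting the subscript $i$) the $27$ edges $u^1w^1,\ w^1x^1,\ x^1y^1,\ y^1z^1,\ z^1v^1$; $u^3w^3,\ w^3x^3,\ x^3y^3,\ y^3z^3,\ z^3v^3$; $u^1w^2,\ u^2w^1,\ u^2w^3,\ u^3w^2,\ w^2x^2,\ x^2y^2$; $y^1z^2,\ y^2z^1,\ y^2z^3,\ y^3z^2,\ z^2v^2$; $x^1t^1,\ x^2t^1,\ x^3t^1$; $v^1t^2,\ v^2t^2,\ v^3t^2$. The graph $T(n)$ consists of $n$ disjoint segments with indices $i=1,\dots,n$, together with the edges $v_{i-1}^1u_i^1,\ v_{i-1}^2u_i^2,\ v_{i-1}^3u_i^3$ for $2\le i\le n$. Then $T_1(n)$ is $T(n)$ plus the edges $u_1^1v_n^1,u_1^2v_n^2,u_1^3v_n^3$; $T_2(n)$ is $T(n)$ plus the edges $u_1^3v_n^1,u_1^2v_n^2,u_1^1v_n^3$; $T_3(n)$ is $T(n)$ plus the edges $u_1^1v_n^3,u_1^2v_n^1,u_1^3v_n^2$.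 (3) The Pappus graph $P_0$. The Heawood graph $H_0$ is the Levi graph of the Fano plane (the unique $7_3$ configuration); $H_0=D(7)$. The Pappus graph $P_0$ is the Levi graph of the Pappus $9_3$ configuration; explicitly, it has vertices $v_1,\dots,v_{18}$, the edges of the circuit $v_1v_2\cdots v_{18}v_1$, and the edges $v_1v_6,\ v_2v_9,\ v_3v_{14},\ v_4v_{11},\ v_5v_{16},\ v_7v_{12},\ v_8v_{15},\ v_{10}v_{17},\ v_{13}v_{18}$. -}

module Defs where

open import Data.Empty using (⊥)
open import Data.Fin using (Fin; zero; suc; toℕ)
open import Data.Fin.Properties using (+↔⊎; *↔×; nonZeroIndex; inj⇒≟) renaming (_≟_ to _≟ᶠ_)
open import Data.List using (List; []; _∷_; _++_; _∷ʳ_; length)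
open import Data.List.Membership.Propositional using (_∈_)
import Data.List.Membership.DecPropositional as DecMembership
open import Data.List.Relation.Unary.All using (All; all?; lookup)
open import Data.List.Relation.Unary.Linked using (Linked)
open import Data.List.Relation.Unary.Unique.Propositional using (Unique)
open import Data.Maybe using (Maybe; just; nothing)
open import Data.Nat using (ℕ; suc; _+_; _*_; _≤_; _%_)
open import Data.Nat.Properties using (_≟_)
open import Data.Product using (Σ; ∃; ∃₂; _×_; _,_; proj₁; proj₂)
open import Data.Product.Function.NonDependent.Propositional using (_×-↔_)
open import Data.Product.Properties using (≡-dec)
open import Data.Sum using (_⊎_; inj₁; inj₂)
open import Data.Sum.Function.Propositional using (_⊎-↔_)
open import Data.Unit using (⊤)
open import Data.Vec using (Vec)
import Data.Vec.Membership.Propositional as Vec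
import Data.Vec.Relation.Unary.Unique.Propositional as Vec
open import Function.Bundles using (_↔_; _⇔_; Inverse; mk↔ₛ′)
open import Function.Properties.Inverse using (↔-refl; ↔-sym; ↔-trans; ↔⇒↣)
open import Relation.Binary.Construct.Closure.ReflexiveTransitive using (Star)
open import Relation.Binary.Construct.Closure.Symmetric using (SymClosure; fwd; bwd; symmetric)
open import Relation.Binary.Definitions using (Decidable; DecidableEquality; Symmetric)
open import Relation.Binary.PropositionalEquality using (_≡_; _≢_; refl)
open import Relation.Nullary using (¬_; Dec; no; ¬?)
open import Relation.Nullary.Decidable using (map′; from-yes; _×-dec_; _⊎-dec_)

Finite : Set → Set
Finite A = ∃ λ n → A ↔ Fin n

Exactly : {A : Set} → ℕ → (A → Set) → Set
Exactly {A} k P = Σ (Vec A k) λ xs → Vec.Unique xs × (∀ x → P x ⇔ x Vec.∈ xs)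

record Graph : Set₁ where
  field
    Vertex     : Set
    finite     : Finite Vertex
    Adj        : Vertex → Vertex → Set
    adj?       : Decidable Adj
    adj-sym    : Symmetric Adj
    adj-irrefl : ∀ v → ¬ Adj v v

infix 4 _≅_

record _≅_ (G H : Graph) : Set where
  private
    module G = Graph G
    module H = Graph H
  field
    vertices : G.Vertex ↔ H.Vertex
  open Inverse vertices using (to) public
  field
    adjacency : ∀ u v → G.Adj u v ⇔ H.Adj (to u) (to v)

-- The empty graph does not count as connected.
Connected : Graph → Set
Connected G = Vertex × (∀ u v → Star Adj u v)
  where open Graph G

-- A circuit x₀ x₁ … x_m x₀ of the graph with edge relation E, with m ≥ 2.
record Circuit {V : Set} (E : V → V → Set) : Set where
  field
    first : V
    rest  : List V

  vertices : List V
  vertices = first ∷ rest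

  closedWalk : List V
  closedWalk = vertices ∷ʳ first

  field
    long   : 2 ≤ length rest
    simple : Unique vertices
    linked : Linked E closedWalk

  OnVertex : V → Set
  OnVertex v = v ∈ vertices

  Traverses : V → V → Set
  Traverses u v = ∃₂ λ ys zs → closedWalk ≡ ys ++ u ∷ v ∷ zs

  OnEdge : V → V → Set
  OnEdge = SymClosure Traverses

record TwoFactor (G : Graph) : Set₁ where
  open Graph G
  field
    E          : Vertex → Vertex → Set
    E⊆Adj      : ∀ {u v} → E u v → Adj u v
    E-sym      : Symmetric E
    two-valent : ∀ v → Exactly 2 (E v)

record IsDisjointUnionOfCircuits {G : Graph} (F : TwoFactor G) (k : ℕ) : Set where
  open Graph G
  open TwoFactor F
  field
    circuit  : Fin k → Circuit E
    disjoint : ∀ {v} i j → Circuit.OnVertex (circuit i) v → Circuit.OnVertex (circuit j) v → i ≡ j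
    covers-V : ∀ v → ∃ λ i → Circuit.OnVertex (circuit i) v
    covers-E : ∀ {u v} → E u v → ∃ λ i → Circuit.OnEdge (circuit i) u v

PseudoTwoFactorIsomorphic : Graph → Set₁
PseudoTwoFactorIsomorphic G =
  (F F′ : TwoFactor G) (k k′ : ℕ) →
  IsDisjointUnionOfCircuits F k → IsDisjointUnionOfCircuits F′ k′ →
  k % 2 ≡ k′ % 2

record IncidenceStructure : Set₁ where
  infix 4 _I_
  field
    Point : Set
    Line  : Set
    _I_   : Point → Line → Set

record _≅ᴵ_ (S T : IncidenceStructure) : Set where
  private
    module S = IncidenceStructure S
    module T = IncidenceStructure T
  field
    points    : S.Point ↔ T.Point
    lines     : S.Line ↔ T.Line
    incidence : ∀ p l → (p S.I l) ⇔ (Inverse.to points p T.I Inverse.to lines l)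

Linear : IncidenceStructure → Set
Linear S = ∀ {p q l m} → p ≢ q → p I l → q I l → p I m → q I m → l ≡ m
  where open IncidenceStructure S

levi : (S : IncidenceStructure) →
       Finite (IncidenceStructure.Point S) → Finite (IncidenceStructure.Line S) →
       Decidable (IncidenceStructure._I_ S) → Graph
levi S (m , points) (n , lines) _I?_ = record
  { Vertex     = Point ⊎ Line
  ; finite     = m + n , ↔-trans (points ⊎-↔ lines) (↔-sym +↔⊎)
  ; Adj        = Adj
  ; adj?       = adj?
  ; adj-sym    = λ {u} {v} → adj-sym u v
  ; adj-irrefl = λ { (inj₁ _) () ; (inj₂ _) () }
  }
  where
  open IncidenceStructure S

  Adj : Point ⊎ Line → Point ⊎ Line → Set
  Adj (inj₁ p) (inj₂ l) = p I l
  Adj (inj₂ l) (inj₁ p) = p I l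
  Adj (inj₁ _) (inj₁ _) = ⊥
  Adj (inj₂ _) (inj₂ _) = ⊥

  adj? : Decidable Adj
  adj? (inj₁ p) (inj₂ l) = p I? l
  adj? (inj₂ l) (inj₁ p) = p I? l
  adj? (inj₁ _) (inj₁ _) = no λ ()
  adj? (inj₂ _) (inj₂ _) = no λ ()

  adj-sym : ∀ u v → Adj u v → Adj v u
  adj-sym (inj₁ _) (inj₂ _) pIl = pIl
  adj-sym (inj₂ _) (inj₁ _) pIl = pIl

record Configuration (n : ℕ) : Set₁ where
  field
    structure : IncidenceStructure
  open IncidenceStructure structure public
  field
    points          : Point ↔ Fin n
    lines           : Line ↔ Fin n
    _I?_            : Decidable _I_
    linear          : Linear structure
    lines-on-point  : ∀ p → Exactly 3 (λ l → p I l)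
    points-on-line  : ∀ l → Exactly 3 (λ p → p I l)

LeviGraph : ∀ {n} → Configuration n → Graph
LeviGraph {n} C = levi structure (n , points) (n , lines) _I?_
  where open Configuration C

record MartinettiData {n : ℕ} (C : Configuration n) : Set where
  open Configuration C
  field
    a b               : Line
    α α₁ α₂ β β₁ β₂   : Point
    a-points          : ∀ p → p I a ⇔ p ∈ α ∷ α₁ ∷ α₂ ∷ []
    b-points          : ∀ p → p I b ⇔ p ∈ β ∷ β₁ ∷ β₂ ∷ []
    non-intersecting  : ∀ p → ¬ (p I a × p I b)
    non-collinear     : ∀ l → ¬ (α I l × β I l)

module _ {n : ℕ} {C : Configuration n} (M : MartinettiData C) where
  open Configuration C
  open MartinettiData M

  -- The proofs in `old` are irrelevant so that each surviving line occurs once.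
  data ExtendedLine : Set where
    old                : (l : Line) → .(l ≢ a) → .(l ≢ b) → ExtendedLine
    μα₁α₂ μβ₁β₂ μαβ    : ExtendedLine

  -- `nothing` is the new point μ.
  martinettiExtension : IncidenceStructure
  martinettiExtension = record
    { Point = Maybe Point
    ; Line  = ExtendedLine
    ; _I_   = _I⁺_
    }
    where
    _I⁺_ : Maybe Point → ExtendedLine → Set
    just p  I⁺ old l _ _ = p I l
    nothing I⁺ old _ _ _ = ⊥
    just p  I⁺ μα₁α₂     = p ∈ α₁ ∷ α₂ ∷ []
    just p  I⁺ μβ₁β₂     = p ∈ β₁ ∷ β₂ ∷ []
    just p  I⁺ μαβ       = p ∈ α ∷ β ∷ []
    nothing I⁺ μα₁α₂     = ⊤
    nothing I⁺ μβ₁β₂     = ⊤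
    nothing I⁺ μαβ       = ⊤

Irreducible : ∀ {n} → Configuration n → Set₁
Irreducible {n} D =
  ∀ m → n ≡ suc m → (C : Configuration m) (M : MartinettiData C) →
  ¬ (martinettiExtension M ≅ᴵ Configuration.structure D)

IrreducibleLeviGraph : Graph → Set₁
IrreducibleLeviGraph G =
  ∃ λ n → Σ (Configuration n) λ C →
  Connected (LeviGraph C) × Irreducible C × G ≅ LeviGraph C

cyclicLine : (n : ℕ) → Fin n → List ℕ
cyclicLine n i = toℕ i % n ∷ (toℕ i + 1) % n ∷ (toℕ i + 3) % n ∷ []
  where instance _ = nonZeroIndex i

-- ℤₙ is represented by Fin n.
cyclic : ℕ → IncidenceStructure
cyclic n = record
  { Point = Fin n
  ; Line  = Fin n
  ; _I_   = λ p i → toℕ p ∈ cyclicLine n i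
  }

D : ℕ → Graph
D n = levi (cyclic n) (n , ↔-refl) (n , ↔-refl) (λ p i → toℕ p ∈? cyclicLine n i)
  where open DecMembership _≟_ using (_∈?_)

module _ {V : Set} {R : V → V → Set} where

  symClosure? : Decidable R → Decidable (SymClosure R)
  symClosure? R? u v = map′
    (λ { (inj₁ r) → fwd r ; (inj₂ r) → bwd r })
    (λ { (fwd r) → inj₁ r ; (bwd r) → inj₂ r })
    (R? u v ⊎-dec R? v u)

  symClosure-irrefl : (∀ v → ¬ R v v) → ∀ v → ¬ SymClosure R v v
  symClosure-irrefl irr v (fwd r) = irr v r
  symClosure-irrefl irr v (bwd r) = irr v r

fromArcs : {V : Set} → Finite V → (R : V → V → Set) → Decidable R → (∀ v → ¬ R v v) → Graph
fromArcs {V} fin R R? irr = record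
  { Vertex     = V
  ; finite     = fin
  ; Adj        = SymClosure R
  ; adj?       = symClosure? R?
  ; adj-sym    = symmetric R
  ; adj-irrefl = symClosure-irrefl irr
  }

module Segment where

  data SegmentVertex : Set where
    u w x y z v : Fin 3 → SegmentVertex
    t           : Fin 2 → SegmentVertex

  pattern ¹ = zero
  pattern ² = suc zero
  pattern ³ = suc (suc zero)

  segmentVertices : SegmentVertex ↔ Fin 20
  segmentVertices = ↔-trans (mk↔ₛ′ to from to∘from from∘to)
                   (↔-trans (↔-sym *↔× ⊎-↔ ↔-refl) (↔-sym +↔⊎))
    where
    to : SegmentVertex → (Fin 6 × Fin 3) ⊎ Fin 2
    to (u j) = inj₁ (zero , j)
    to (w j) = inj₁ (suc zero , j)
    to (x j) = inj₁ (suc (suc zero) , j)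
    to (y j) = inj₁ (suc (suc (suc zero)) , j)
    to (z j) = inj₁ (suc (suc (suc (suc zero))) , j)
    to (v j) = inj₁ (suc (suc (suc (suc (suc zero)))) , j)
    to (t j) = inj₂ j

    from : (Fin 6 × Fin 3) ⊎ Fin 2 → SegmentVertex
    from (inj₁ (zero , j))                                = u j
    from (inj₁ (suc zero , j))                            = w j
    from (inj₁ (suc (suc zero) , j))                      = x j
    from (inj₁ (suc (suc (suc zero)) , j))                = y j
    from (inj₁ (suc (suc (suc (suc zero))) , j))          = z j
    from (inj₁ (suc (suc (suc (suc (suc zero)))) , j))    = v j
    from (inj₂ j)                                         = t j

    to∘from : ∀ k → to (from k) ≡ k
    to∘from (inj₁ (zero , j))                             = refl
    to∘from (inj₁ (suc zero , j))                         = refl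
    to∘from (inj₁ (suc (suc zero) , j))                   = refl
    to∘from (inj₁ (suc (suc (suc zero)) , j))             = refl
    to∘from (inj₁ (suc (suc (suc (suc zero))) , j))       = refl
    to∘from (inj₁ (suc (suc (suc (suc (suc zero)))) , j)) = refl
    to∘from (inj₂ j)                                      = refl

    from∘to : ∀ s → from (to s) ≡ s
    from∘to (u j) = refl
    from∘to (w j) = refl
    from∘to (x j) = refl
    from∘to (y j) = refl
    from∘to (z j) = refl
    from∘to (v j) = refl
    from∘to (t j) = refl

  _≟ˢ_ : DecidableEquality SegmentVertex
  _≟ˢ_ = inj⇒≟ (↔⇒↣ segmentVertices)

  open DecMembership (≡-dec _≟ˢ_ _≟ˢ_) using () renaming (_∈?_ to _∈ˢ?_)

  segmentEdges : List (SegmentVertex × SegmentVertex)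
  segmentEdges =
      (u ¹ , w ¹) ∷ (w ¹ , x ¹) ∷ (x ¹ , y ¹) ∷ (y ¹ , z ¹) ∷ (z ¹ , v ¹)
    ∷ (u ³ , w ³) ∷ (w ³ , x ³) ∷ (x ³ , y ³) ∷ (y ³ , z ³) ∷ (z ³ , v ³)
    ∷ (u ¹ , w ²) ∷ (u ² , w ¹) ∷ (u ² , w ³) ∷ (u ³ , w ²) ∷ (w ² , x ²) ∷ (x ² , y ²)
    ∷ (y ¹ , z ²) ∷ (y ² , z ¹) ∷ (y ² , z ³) ∷ (y ³ , z ²) ∷ (z ² , v ²)
    ∷ (x ¹ , t ¹) ∷ (x ² , t ¹) ∷ (x ³ , t ¹)
    ∷ (v ¹ , t ²) ∷ (v ² , t ²) ∷ (v ³ , t ²)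
    ∷ []

  -- Edges v_{i-1}u_i between consecutive segments.
  linkEdges : List (SegmentVertex × SegmentVertex)
  linkEdges = (v ¹ , u ¹) ∷ (v ² , u ²) ∷ (v ³ , u ³) ∷ []

  -- Edges v_n u_1 from the last segment to the first, for T₁, T₂ and T₃.
  closing₁ closing₂ closing₃ : List (SegmentVertex × SegmentVertex)
  closing₁ = (v ¹ , u ¹) ∷ (v ² , u ²) ∷ (v ³ , u ³) ∷ []
  closing₂ = (v ¹ , u ³) ∷ (v ² , u ²) ∷ (v ³ , u ¹) ∷ []
  closing₃ = (v ³ , u ¹) ∷ (v ¹ , u ²) ∷ (v ² , u ³) ∷ []

  Loopless : List (SegmentVertex × SegmentVertex) → Set
  Loopless = All (λ e → proj₁ e ≢ proj₂ e)

  loopless? : ∀ es → Dec (Loopless es)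
  loopless? = all? (λ e → ¬? (proj₁ e ≟ˢ proj₂ e))

  -- The indices 1, …, n of the segments are represented by Fin n.
  data Arc (n : ℕ) (closing : List (SegmentVertex × SegmentVertex)) :
           Fin n × SegmentVertex → Fin n × SegmentVertex → Set where
    segment : ∀ {i r s} → (r , s) ∈ segmentEdges → Arc n closing (i , r) (i , s)
    link    : ∀ {i j r s} → suc (toℕ i) ≡ toℕ j → (r , s) ∈ linkEdges → Arc n closing (i , r) (j , s)
    close   : ∀ {i j r s} → suc (toℕ i) ≡ n → toℕ j ≡ 0 → (r , s) ∈ closing → Arc n closing (i , r) (j , s)

  arc? : ∀ n closing → Decidable (Arc n closing)
  arc? n closing (i , r) (j , s) = map′
    (λ { (inj₁ (refl , e))            → segment e
       ; (inj₂ (inj₁ (p , e)))        → link p e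
       ; (inj₂ (inj₂ (p , q , e)))    → close p q e })
    (λ { (segment e)   → inj₁ (refl , e)
       ; (link p e)    → inj₂ (inj₁ (p , e))
       ; (close p q e) → inj₂ (inj₂ (p , q , e)) })
    (     (i ≟ᶠ j ×-dec (r , s) ∈ˢ? segmentEdges)
    ⊎-dec (suc (toℕ i) ≟ toℕ j ×-dec (r , s) ∈ˢ? linkEdges)
    ⊎-dec (suc (toℕ i) ≟ n ×-dec toℕ j ≟ 0 ×-dec (r , s) ∈ˢ? closing))

  arc-irrefl : ∀ n {closing} → Loopless closing → ∀ a → ¬ Arc n closing a a
  arc-irrefl n ok a (segment e)   = lookup (from-yes (loopless? segmentEdges)) e refl
  arc-irrefl n ok a (link _ e)    = lookup (from-yes (loopless? linkEdges)) e refl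
  arc-irrefl n ok a (close _ _ e) = lookup ok e refl

  T : (closing : List (SegmentVertex × SegmentVertex)) → Loopless closing → ℕ → Graph
  T closing ok n = fromArcs
    (n * 20 , ↔-trans (↔-refl ×-↔ segmentVertices) (↔-sym *↔×))
    (Arc n closing) (arc? n closing) (arc-irrefl n ok)

  T₁ T₂ T₃ : ℕ → Graph
  T₁ = T closing₁ (from-yes (loopless? closing₁))
  T₂ = T closing₂ (from-yes (loopless? closing₂))
  T₃ = T closing₃ (from-yes (loopless? closing₃))

open Segment public using (T₁; T₂; T₃)

-- The cyclic configuration with lines {i, i+1, i+3} in ℤ₇ is the Fano plane.
heawood : Graph
heawood = D 7

pappusEdges : List (ℕ × ℕ)
pappusEdges =
    (1 , 2) ∷ (2 , 3) ∷ (3 , 4) ∷ (4 , 5) ∷ (5 , 6) ∷ (6 , 7) ∷ (7 , 8) ∷ (8 , 9) ∷ (9 , 10)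
  ∷ (10 , 11) ∷ (11 , 12) ∷ (12 , 13) ∷ (13 , 14) ∷ (14 , 15) ∷ (15 , 16) ∷ (16 , 17) ∷ (17 , 18) ∷ (18 , 1)
  ∷ (1 , 6) ∷ (2 , 9) ∷ (3 , 14) ∷ (4 , 11) ∷ (5 , 16) ∷ (7 , 12) ∷ (8 , 15) ∷ (10 , 17) ∷ (13 , 18)
  ∷ []

-- The vertex v_k is represented by k - 1 in Fin 18.
pappus : Graph
pappus = fromArcs (18 , ↔-refl)
  (λ i j → (suc (toℕ i) , suc (toℕ j)) ∈ pappusEdges)
  (λ i j → (suc (toℕ i) , suc (toℕ j)) ∈? pappusEdges)
  (λ i e → lookup (from-yes (all? (λ e → ¬? (proj₁ e ≟ proj₂ e)) pappusEdges)) e refl)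
  where open DecMembership (≡-dec _≟_ _≟_) using (_∈?_)

InBobenList : Graph → Set
InBobenList G =
    (∃ λ n → 7 ≤ n × G ≅ D n)
  ⊎ (∃ λ n → 1 ≤ n × (G ≅ T₁ n ⊎ G ≅ T₂ n ⊎ G ≅ T₃ n))
  ⊎ G ≅ pappus

BobenTheorem : Set₁
BobenTheorem = ∀ G → IrreducibleLeviGraph G ⇔ InBobenList G

{-# OPTIONS --safe #-}
module Submission where

-- By Boben's list it suffices to decide the property for D(n), Tᵢ(n) and the Pappus graph.
--
-- A 2-factor of a cubic graph is the complement of a perfect matching, and its number of
-- circuits is its number of components. For the Heawood and the Pappus graph all perfect
-- matchings (24 and 42) are enumerated by evaluation; all complements have an odd number
-- of components.
--
-- For n ≥ 8 the graph D(n) has a Hamiltonian circuit and a 2-factor with two circuits: for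
-- even n, lines i alternate with points i+1, i+3, …, and the parity of i gives two circuits;
-- for odd n, a long circuit repeats a pattern of period 4 and leaves out one circuit of
-- length 6 (n ≡ 1 mod 4) or 14 (n ≡ 3 mod 4).
--
-- Tᵢ(n) has a 2-factor in which every circuit lives in two consecutive segments, one circuit
-- for each of the n pairs; in the first segment a piece of one circuit can be split off
-- as a circuit of its own, which gives n+1 circuits.

open import Defs
open import Data.Bool using (Bool; true; false; not; if_then_else_)
open import Data.Empty using (⊥)
open import Data.Fin using (Fin; zero; suc; toℕ; fromℕ; fromℕ<; inject₁)
open import Data.Fin.Properties using (all?; any?; toℕ<n; toℕ-injective; toℕ-fromℕ; toℕ-fromℕ<; toℕ-inject₁; inject₁-injective; fromℕ≢inject₁; punchOut-injective; <⇒notInjective; cantor-schröder-bernstein) renaming (_≟_ to _≟ᶠ_)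
open import Data.Fin.Relation.Unary.Top using (view; ‵fromℕ; ‵inject₁)
open import Data.List using (List; []; _∷_; _++_; _∷ʳ_; length; map; filter; foldl; lookup; concatMap; allFin)
open import Data.List.Membership.Propositional using (_∈_; _∉_)
import Data.List.Membership.DecPropositional as DecMembership
open import Data.List.Membership.Propositional.Properties using (∈-map⁺; ∈-map⁻; ∈-++⁺ˡ; ∈-++⁺ʳ; ∈-++⁻; ∈-lookup; ∈-filter⁺; ∈-filter⁻; ∈-allFin; ∈-concatMap⁺)
open import Data.List.Properties using (map-++; length-map; length-++; tabulate-lookup; ++-assoc; ++-identityʳ)
open import Data.List.Relation.Unary.All using (All; []; _∷_)
import Data.List.Relation.Unary.All as All
import Data.List.Relation.Unary.All.Properties as All
open import Data.List.Relation.Unary.AllPairs using ([]; _∷_)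
open import Data.List.Relation.Unary.Any using (Any; here; there; index)
import Data.List.Relation.Unary.Any as Any using (map)
open import Data.List.Relation.Unary.Any.Properties using (lookup-index)
import Data.List.Relation.Unary.Any.Properties as Any using (map⁺)
open import Data.List.Relation.Unary.Linked using (Linked; []; [-]; _∷_; linked?)
import Data.List.Relation.Unary.Linked as Linked using (map)
import Data.List.Relation.Unary.Linked.Properties as Linked using (map⁺)
open import Data.List.Relation.Unary.Unique.DecPropositional using (unique?)
open import Data.List.Relation.Unary.Unique.Propositional using (Unique)
import Data.List.Relation.Unary.Unique.Propositional.Properties as Unique
open import Data.Nat using (ℕ; zero; suc; _+_; _*_; _∸_; _≤_; _<_; _≤?_; _<?_; _%_; z≤n; s≤s; NonZero) renaming (_≟_ to _≟ⁿ_)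
open import Data.Nat.DivMod using (_mod_; m%n%n≡m%n; %-distribˡ-+; [m+n]%n≡m%n; m<n⇒m%n≡m; m%n<n)
open import Data.Nat.Properties using (+-assoc; +-comm; +-identityʳ; +-suc; +-cancelʳ-<; +-monoʳ-≤; *-identityʳ; m≤m*n; m∸n+n≡m; m≤n⇒∃[o]m+o≡n; n<1+n; ≮⇒≥; ≤-refl; ≤-trans; ≤-reflexive; <-irrefl; <-trans; <-≤-trans)
open import Data.Nat.Solver using (module +-*-Solver)
open import Data.Product using (∃; ∃₂; _×_; _,_; proj₁; proj₂; map₂)
import Data.Product.Properties as Product using (≡-dec)
open import Data.Sum using (_⊎_; inj₁; inj₂; [_,_]; [_,_]′; swap)
import Data.Sum as Sum using (map)
open import Data.Sum.Properties using (inj₁-injective)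
import Data.Sum.Properties as Sum using (≡-dec)
open import Data.Vec using (Vec; []; _∷_)
import Data.Vec as Vec using (map)
import Data.Vec.Membership.Propositional as Vec using (_∈_)
import Data.Vec.Membership.Propositional.Properties as Vec using (∈-map⁺)
open import Data.Vec.Relation.Unary.All using ([]; _∷_)
open import Data.Vec.Relation.Unary.AllPairs using ([]; _∷_)
open import Data.Vec.Relation.Unary.Any using (here; there)
import Data.Vec.Relation.Unary.Unique.Propositional.Properties as Vec using (map⁺)
open import Function using (_∘_; id)
open import Function.Bundles using (_↔_; _⇔_; Inverse; Equivalence; mk⇔)
open import Function.Properties.Inverse using (↔-sym)
open import Relation.Binary.Construct.Closure.ReflexiveTransitive using (Star; ε; _◅_; _◅◅_; reverse)
open import Relation.Binary.Construct.Closure.Symmetric using (SymClosure; fwd; bwd)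
import Relation.Binary.Construct.Closure.Symmetric as Sym using (symmetric)
open import Relation.Binary.Definitions using (DecidableEquality; Symmetric)
open import Relation.Binary.PropositionalEquality using (_≡_; _≢_; refl; sym; trans; cong; cong₂; subst; subst₂; ≢-sym; module ≡-Reasoning)
open import Relation.Nullary using (¬_; Dec; yes; no; does; ¬?; contradiction)
open import Relation.Nullary.Decidable using (True; toWitness; from-yes; map′; decidable-stable; _⊎-dec_; _×-dec_)
open import Relation.Unary using (Decidable)

private variable
  V W : Set

open Equivalence using (to; from)

-- Invariance under graph isomorphism

≅-sym : ∀ {G H} → G ≅ H → H ≅ G
≅-sym {G} {H} iso = record
  { vertices  = ↔-sym I.vertices
  ; adjacency = λ u v → mk⇔
      (λ a → from (I.adjacency _ _) (subst₂ H.Adj (sym (strictlyInverseˡ u)) (sym (strictlyInverseˡ v)) a))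
      (λ a → subst₂ H.Adj (strictlyInverseˡ u) (strictlyInverseˡ v) (to (I.adjacency _ _) a))
  }
  where
  module H = Graph H
  module I = _≅_ iso
  open Inverse I.vertices using (strictlyInverseˡ)

-- For the closed walk of a circuit this is `Circuit.Traverses`.
Consecutive : List V → V → V → Set
Consecutive w u v = ∃₂ λ ys zs → w ≡ ys ++ u ∷ v ∷ zs

consecutive-map : (f : V → W) {w : List V} {u v : V} →
                  Consecutive w u v → Consecutive (map f w) (f u) (f v)
consecutive-map f {u = u} {v} (ys , zs , refl) = map f ys , map f zs , map-++ f ys (u ∷ v ∷ zs)

module _ {G H : Graph} (iso : G ≅ H) where
  private
    module G = Graph G
    module H = Graph H
    module I = _≅_ iso
  open Inverse I.vertices using (strictlyInverseˡ; strictlyInverseʳ) renaming (to to φ; from to ψ)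

  private
    ψ-injective : ∀ {x y} → ψ x ≡ ψ y → x ≡ y
    ψ-injective {x} {y} eq = trans (sym (strictlyInverseˡ x)) (trans (cong φ eq) (strictlyInverseˡ y))

  pullback : TwoFactor H → TwoFactor G
  pullback F = record
    { E          = λ u v → F.E (φ u) (φ v)
    ; E⊆Adj      = λ e → from (I.adjacency _ _) (F.E⊆Adj e)
    ; E-sym      = F.E-sym
    ; two-valent = λ v → pull v (F.two-valent (φ v))
    }
    where
    module F = TwoFactor F
    pull : ∀ v → Exactly 2 (F.E (φ v)) → Exactly 2 (λ u → F.E (φ v) (φ u))
    pull v (xs , uniq , mem) = Vec.map ψ xs , Vec.map⁺ ψ-injective uniq , λ u → mk⇔
      (λ e → subst (λ u → u Vec.∈ Vec.map ψ xs) (strictlyInverseʳ u) (Vec.∈-map⁺ ψ (to (mem (φ u)) e)))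
      (λ i → from (mem (φ u)) (unmap xs i))
      where
      unmap : ∀ {n u} (xs : Vec H.Vertex n) → u Vec.∈ Vec.map ψ xs → φ u Vec.∈ xs
      unmap (x ∷ xs) (here refl) = here (strictlyInverseˡ x)
      unmap (x ∷ xs) (there i)   = there (unmap xs i)

  pullback-circuits : ∀ {F k} → IsDisjointUnionOfCircuits F k → IsDisjointUnionOfCircuits (pullback F) k
  pullback-circuits {F} D = record
    { circuit  = circuit
    ; disjoint = λ i j p q → D.disjoint i j (on⁻ p) (on⁻ q)
    ; covers-V = λ v → let i , p = D.covers-V (φ v) in
                       i , subst (λ u → u ∈ Circuit.vertices (circuit i)) (strictlyInverseʳ v) (∈-map⁺ ψ p)
    ; covers-E = λ e → let i , p = D.covers-E e in i , edge i p
    }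
    where
    module F = TwoFactor F
    module D = IsDisjointUnionOfCircuits D

    closed-map : (c : Circuit F.E) → map ψ (Circuit.closedWalk c) ≡
                 map ψ (Circuit.vertices c) ∷ʳ ψ (Circuit.first c)
    closed-map c = map-++ ψ (Circuit.vertices c) (Circuit.first c ∷ [])

    circuit : _ → Circuit (TwoFactor.E (pullback F))
    circuit i = record
      { first  = ψ C.first
      ; rest   = map ψ C.rest
      ; long   = subst (2 ≤_) (sym (length-map ψ C.rest)) C.long
      ; simple = Unique.map⁺ ψ-injective C.simple
      ; linked = subst (Linked _) (closed-map (D.circuit i)) (Linked.map⁺ (Linked.map
                   (λ {x} {y} → subst₂ F.E (sym (strictlyInverseˡ x)) (sym (strictlyInverseˡ y))) C.linked))
      }
      where module C = Circuit (D.circuit i)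

    on⁻ : ∀ {v xs} → v ∈ map ψ xs → φ v ∈ xs
    on⁻ {v} {xs} p with x , q , refl ← ∈-map⁻ ψ p = subst (_∈ xs) (sym (strictlyInverseˡ x)) q

    traverses : ∀ {u v} i → Circuit.Traverses (D.circuit i) (φ u) (φ v) → Circuit.Traverses (circuit i) u v
    traverses {u} {v} i p = subst₂ (Circuit.Traverses (circuit i)) (strictlyInverseʳ u) (strictlyInverseʳ v)
      (subst (λ w → Consecutive w (ψ (φ u)) (ψ (φ v))) (closed-map (D.circuit i)) (consecutive-map ψ p))

    edge : ∀ {u v} i → Circuit.OnEdge (D.circuit i) (φ u) (φ v) → Circuit.OnEdge (circuit i) u v
    edge i (fwd p) = fwd (traverses i p)
    edge i (bwd p) = bwd (traverses i p)

  -- Two 2-factors of `H`, decomposed into circuits, pull back to 2-factors of `G` with the same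
  -- numbers of circuits.
  pseudoTwoFactorIsomorphic-resp-≅ : PseudoTwoFactorIsomorphic G → PseudoTwoFactorIsomorphic H
  pseudoTwoFactorIsomorphic-resp-≅ P F F′ k k′ D D′ =
    P (pullback F) (pullback F′) k k′ (pullback-circuits D) (pullback-circuits D′)

-- Steps along closed walks

data Next {V : Set} : List V → V → V → Set where
  here  : ∀ {u v zs} → Next (u ∷ v ∷ zs) u v
  there : ∀ {x w u v} → Next w u v → Next (x ∷ w) u v

-- The inductive `Next` serves for recursion along a walk; circuits are defined through the
-- splittings in `Consecutive`.
next⇒consecutive : ∀ {w} {u v : V} → Next w u v → Consecutive w u v
next⇒consecutive (here {zs = zs})     = [] , zs , refl
next⇒consecutive (there {x = x} p) with ys , zs , refl ← next⇒consecutive p = x ∷ ys , zs , refl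

consecutive⇒next : ∀ {w} {u v : V} → Consecutive w u v → Next w u v
consecutive⇒next (ys , zs , refl) = go ys
  where
  go : ∀ ys → Next (ys ++ _ ∷ _ ∷ zs) _ _
  go []       = here
  go (y ∷ ys) = there (go ys)

linked-next : (w : List V) → Linked (Next w) w
linked-next []          = []
linked-next (x ∷ [])    = [-]
linked-next (x ∷ y ∷ w) = here ∷ Linked.map there (linked-next (y ∷ w))

linked⇒next : ∀ {R : V → V → Set} {w u v} → Linked R w → Next w u v → R u v
linked⇒next (r ∷ _)  here      = r
linked⇒next (_ ∷ rs) (there p) = linked⇒next rs p

-- A closed walk `(f ∷ rest) ∷ʳ f` has both the shapes `xs ∷ʳ f` and `f ∷ xs`. Successors are
-- studied in the first and predecessors in the second, so that on a circuit `xs` lists every vertex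
-- once in either case.
next-source : ∀ xs {f} {u v : V} → Next (xs ∷ʳ f) u v → u ∈ xs
next-source []           (there ())
next-source (x ∷ [])     here      = here refl
next-source (x ∷ [])     (there (there ()))
next-source (x ∷ y ∷ xs) here      = here refl
next-source (x ∷ y ∷ xs) (there p) = there (next-source (y ∷ xs) p)

next-target : ∀ {f xs} {u v : V} → Next (f ∷ xs) u v → v ∈ xs
next-target here                         = here refl
next-target {xs = x ∷ xs} (there p) = there (next-target p)

successor : ∀ xs {f} {u : V} → u ∈ xs → ∃ (Next (xs ∷ʳ f) u)
successor (x ∷ [])     (here refl) = _ , here
successor (x ∷ y ∷ xs) (here refl) = _ , here
successor (x ∷ xs)     (there p)   = let v , q = successor xs p in v , there q

predecessor : ∀ {f xs} {v : V} → v ∈ xs → ∃ λ u → Next (f ∷ xs) u v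
predecessor (here refl) = _ , here
predecessor (there p)   = let u , q = predecessor p in u , there q

unique-head : ∀ {x : V} {xs} → Unique (x ∷ xs) → x ∉ xs
unique-head = Unique.Unique[x∷xs]⇒x∉xs

successor-unique : ∀ xs {f} {u v v′ : V} → Unique xs → Next (xs ∷ʳ f) u v → Next (xs ∷ʳ f) u v′ → v ≡ v′
successor-unique []           _        (there ())
successor-unique (x ∷ [])     _        here      here      = refl
successor-unique (x ∷ [])     _        here      (there (there ()))
successor-unique (x ∷ [])     _        (there (there ()))
successor-unique (x ∷ y ∷ xs) _        here      here      = refl
successor-unique (x ∷ y ∷ xs) un       here      (there q) = contradiction (next-source (y ∷ xs) q) (unique-head un)
successor-unique (x ∷ y ∷ xs) un       (there p) here      = contradiction (next-source (y ∷ xs) p) (unique-head un)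
successor-unique (x ∷ y ∷ xs) (_ ∷ un) (there p) (there q) = successor-unique (y ∷ xs) un p q

predecessor-unique : ∀ {f xs} {u u′ v : V} → Unique xs → Next (f ∷ xs) u v → Next (f ∷ xs) u′ v → u ≡ u′
predecessor-unique _        here      here      = refl
predecessor-unique un       here      (there q) = contradiction (next-target q) (unique-head un)
predecessor-unique un       (there p) here      = contradiction (next-target p) (unique-head un)
predecessor-unique {xs = _ ∷ _} (_ ∷ un) (there p) (there q) = predecessor-unique un p q

next-asym : ∀ {xs} {u v : V} → Unique xs → Next xs u v → ¬ Next xs v u
next-asym un       here      q         = contradiction (next-target q) (unique-head un)
next-asym un       (there p) here      = contradiction (there (next-target p)) (unique-head un)
next-asym (_ ∷ un) (there p) (there q) = next-asym un p q

∷ʳ⇒∷ : ∀ xs {x y : V} → y ∈ xs ∷ʳ x → y ∈ x ∷ xs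
∷ʳ⇒∷ xs p = [ there , (λ { (here eq) → here eq }) ]′ (∈-++⁻ xs p)

∷⇒∷ʳ : ∀ xs {x y : V} → y ∈ x ∷ xs → y ∈ xs ∷ʳ x
∷⇒∷ʳ xs (here eq) = ∈-++⁺ʳ xs (here eq)
∷⇒∷ʳ xs (there p) = ∈-++⁺ˡ p

rotate-unique : ∀ {x : V} {xs} → Unique (x ∷ xs) → Unique (xs ∷ʳ x)
rotate-unique un@(_ ∷ un′) = Unique.++⁺ un′ ([] ∷ []) λ { (p , here refl) → unique-head un p }

-- With at least three vertices, a step back from `a` to `f` would give `a` the two successors `f`
-- and `b`. Two opposite steps that both avoid leaving `f` at the start lie in `rest ∷ʳ f`, whose
-- entries are distinct.
closed-asym : ∀ {f rest} {u v : V} → 2 ≤ length rest → Unique (f ∷ rest) →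
              Next ((f ∷ rest) ∷ʳ f) u v → ¬ Next ((f ∷ rest) ∷ʳ f) v u
closed-asym {rest = _ ∷ []} (s≤s ())
closed-asym {f = f} {a ∷ b ∷ r} _ un here q =
  unique-head un (there (here (successor-unique (f ∷ a ∷ b ∷ r) un q (there here))))
closed-asym {f = f} {a ∷ b ∷ r} _ un p@(there _) here =
  unique-head un (there (here (successor-unique (f ∷ a ∷ b ∷ r) un p (there here))))
closed-asym {rest = a ∷ b ∷ r} _ un (there p) (there q) = next-asym (rotate-unique un) p q

-- 2-factors given by circuits that partition the vertices

record CircuitPartition (G : Graph) (k : ℕ) : Set where
  open Graph G
  field
    first    : Fin k → Vertex
    rest     : Fin k → List Vertex
    long     : ∀ i → 2 ≤ length (rest i)
    simple   : ∀ i → Unique (first i ∷ rest i)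
    linked   : ∀ i → Linked Adj ((first i ∷ rest i) ∷ʳ first i)
    disjoint : ∀ {v} i j → v ∈ first i ∷ rest i → v ∈ first j ∷ rest j → i ≡ j
    covers   : ∀ v → ∃ λ i → v ∈ first i ∷ rest i

module _ {G : Graph} {k : ℕ} (C : CircuitPartition G k) where
  open Graph G
  open CircuitPartition C

  private
    walk : Fin k → List Vertex
    walk i = (first i ∷ rest i) ∷ʳ first i

    target : ∀ i {u v} → Next (walk i) u v → v ∈ first i ∷ rest i
    target i p = ∷ʳ⇒∷ (rest i) (next-target p)

    source : ∀ i {u v} → Next (walk i) u v → u ∈ first i ∷ rest i
    source i = next-source (first i ∷ rest i)

    circuitEdge : Vertex → Vertex → Set
    circuitEdge u v = ∃ λ i → SymClosure (Consecutive (walk i)) u v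

    -- The two edges at `v` lead to its successor and its predecessor on the circuit through `v`;
    -- these differ by `closed-asym`. By disjointness no other circuit contributes an edge at `v`.
    two-valent : ∀ v → Exactly 2 (circuitEdge v)
    two-valent v with i , v∈ ← covers v
      with s , vs ← successor (first i ∷ rest i) {first i} v∈
      with p , pv ← predecessor {f = first i} {xs = rest i ∷ʳ first i} (∷⇒∷ʳ (rest i) v∈)
      = s ∷ p ∷ []
      , ((s≢p vs pv ∷ []) ∷ ([] ∷ []))
      , λ u → mk⇔ forward λ
          { (here refl)             → i , fwd (next⇒consecutive vs)
          ; (there (here refl)) → i , bwd (next⇒consecutive pv) }
      where
      s≢p : ∀ {s p} → Next (walk i) v s → Next (walk i) p v → s ≢ p
      s≢p vs pv refl = closed-asym (long i) (simple i) vs pv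
      forward : ∀ {u} → circuitEdge v u → u Vec.∈ s ∷ p ∷ []
      forward (j , fwd c) with q ← consecutive⇒next c with refl ← disjoint i j v∈ (source j q) =
        here (successor-unique (first i ∷ rest i) (simple i) q vs)
      forward (j , bwd c) with q ← consecutive⇒next c with refl ← disjoint i j v∈ (target j q) =
        there (here (predecessor-unique (rotate-unique (simple i)) q pv))

  partitionTwoFactor : TwoFactor G
  partitionTwoFactor = record
    { E          = circuitEdge
    ; E⊆Adj      = λ { (i , fwd c) → linked⇒next (linked i) (consecutive⇒next c)
                     ; (i , bwd c) → adj-sym (linked⇒next (linked i) (consecutive⇒next c)) }
    ; E-sym      = λ { (i , e) → i , Sym.symmetric _ e }
    ; two-valent = two-valent
    }

  partitionCircuits : IsDisjointUnionOfCircuits partitionTwoFactor k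
  partitionCircuits = record
    { circuit  = λ i → record
      { first = first i ; rest = rest i ; long = long i ; simple = simple i
      ; linked = Linked.map (λ p → i , fwd (next⇒consecutive p)) (linked-next (walk i)) }
    ; disjoint = disjoint
    ; covers-V = covers
    ; covers-E = id
    }

partition-parity : ∀ {G k k′} → PseudoTwoFactorIsomorphic G →
                   CircuitPartition G k → CircuitPartition G k′ → k % 2 ≡ k′ % 2
partition-parity P C C′ = P _ _ _ _ (partitionCircuits C) (partitionCircuits C′)

parity-alternates : ∀ n → n % 2 ≢ suc n % 2
parity-alternates zero          ()
parity-alternates (suc zero)    ()
parity-alternates (suc (suc n)) = parity-alternates n

-- Distinctness of vertices by counting

injective⇒surjective : ∀ {n} {f : Fin n → Fin n} → (∀ {i j} → f i ≡ f j → i ≡ j) → ∀ j → ∃ λ i → f i ≡ j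
injective⇒surjective {suc n} {f} inj j with any? (λ i → f i ≟ᶠ j)
... | yes hit = hit
-- A missed value `j` can be punched out of the codomain, which leaves an injection into a smaller
-- `Fin`.
... | no miss = contradiction (λ {i} {i′} eq → inj (punchOut-injective (avoid i) (avoid i′) eq))
                              (<⇒notInjective (n<1+n n))
  where
  avoid : ∀ i → j ≢ f i
  avoid i eq = miss (i , sym eq)

-- Each vertex is assigned a position where it occurs. This assignment is injective, hence onto by
-- counting, so each position belongs to its own vertex. Thus circuits need only be checked for
-- total length and covering; simplicity and disjointness follow.
covering⇒unique : ∀ {V : Set} {N} (xs : List V) → V ↔ Fin N → length xs ≡ N → (∀ v → v ∈ xs) → Unique xs
covering⇒unique xs V↔ refl cov = subst Unique (tabulate-lookup xs) (Unique.tabulate⁺ lookup-inj)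
  where
  open Inverse V↔ using (strictlyInverseˡ) renaming (to to φ; from to ψ)
  position : Fin (length xs) → Fin (length xs)
  position i = index (cov (ψ i))
  lookup-position : ∀ i → lookup xs (position i) ≡ ψ i
  lookup-position i = sym (lookup-index (cov (ψ i)))
  ψ-injective : ∀ {i j} → ψ i ≡ ψ j → i ≡ j
  ψ-injective eq = trans (sym (strictlyInverseˡ _)) (trans (cong φ eq) (strictlyInverseˡ _))
  position-surjective : ∀ j → ∃ λ i → position i ≡ j
  position-surjective = injective⇒surjective λ eq → ψ-injective
    (trans (sym (lookup-position _)) (trans (cong (lookup xs) eq) (lookup-position _)))
  lookup-inj : ∀ {i j} → lookup xs i ≡ lookup xs j → i ≡ j
  lookup-inj {i} {j} eq with i′ , refl ← position-surjective i with j′ , refl ← position-surjective j =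
    cong position (ψ-injective (trans (sym (lookup-position i′)) (trans eq (lookup-position j′))))

unique-++⁻ : ∀ {V : Set} (xs : List V) {ys} → Unique (xs ++ ys) →
             Unique xs × Unique ys × (∀ {v} → v ∈ xs → v ∉ ys)
unique-++⁻ []       un = [] , un , λ ()
unique-++⁻ (x ∷ xs) (h ∷ un) with unx , uny , dis ← unique-++⁻ xs un =
  All.++⁻ˡ xs h ∷ unx , uny , λ { (here refl) q → All.lookup (All.++⁻ʳ xs h) q refl ; (there p) q → dis p q }

module _ {V : Set} where

  cycle : V × List V → List V
  cycle (f , r) = f ∷ r

  cycle-unique : ∀ (cs : List (V × List V)) → Unique (concatMap cycle cs) → ∀ i → Unique (cycle (lookup cs i))
  cycle-unique (c ∷ cs) un zero    = proj₁ (unique-++⁻ (cycle c) un)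
  cycle-unique (c ∷ cs) un (suc i) = cycle-unique cs (proj₁ (proj₂ (unique-++⁻ (cycle c) un))) i

  ∈-cycles⁺ : ∀ (cs : List (V × List V)) i {v} → v ∈ cycle (lookup cs i) → v ∈ concatMap cycle cs
  ∈-cycles⁺ (c ∷ cs) zero    p = ∈-++⁺ˡ p
  ∈-cycles⁺ (c ∷ cs) (suc i) p = ∈-++⁺ʳ (cycle c) (∈-cycles⁺ cs i p)

  ∈-cycles⁻ : ∀ (cs : List (V × List V)) {v} → v ∈ concatMap cycle cs → ∃ λ i → v ∈ cycle (lookup cs i)
  ∈-cycles⁻ (c ∷ cs) p with ∈-++⁻ (cycle c) p
  ... | inj₁ q = zero , q
  ... | inj₂ q = let i , r = ∈-cycles⁻ cs q in suc i , r

  cycle-disjoint : ∀ (cs : List (V × List V)) → Unique (concatMap cycle cs) → ∀ {v} i j →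
                   v ∈ cycle (lookup cs i) → v ∈ cycle (lookup cs j) → i ≡ j
  cycle-disjoint (c ∷ cs) un zero    zero    p q = refl
  cycle-disjoint (c ∷ cs) un zero    (suc j) p q =
    contradiction (∈-cycles⁺ cs j q) (proj₂ (proj₂ (unique-++⁻ (cycle c) un)) p)
  cycle-disjoint (c ∷ cs) un (suc i) zero    p q =
    contradiction (∈-cycles⁺ cs i p) (proj₂ (proj₂ (unique-++⁻ (cycle c) un)) q)
  cycle-disjoint (c ∷ cs) un (suc i) (suc j) p q =
    cong suc (cycle-disjoint cs (proj₁ (proj₂ (unique-++⁻ (cycle c) un))) i j p q)

coveringPartition : ∀ {G} (cs : List (Graph.Vertex G × List (Graph.Vertex G))) →
  All (λ c → 2 ≤ length (proj₂ c)) cs →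
  All (λ c → Linked (Graph.Adj G) (cycle c ∷ʳ proj₁ c)) cs →
  length (concatMap cycle cs) ≡ proj₁ (Graph.finite G) →
  (∀ v → v ∈ concatMap cycle cs) →
  CircuitPartition G (length cs)
coveringPartition {G} cs long linked size cov = record
  { first    = λ i → proj₁ (lookup cs i)
  ; rest     = λ i → proj₂ (lookup cs i)
  ; long     = λ i → All.lookup long (∈-lookup i)
  ; simple   = cycle-unique cs un
  ; linked   = λ i → All.lookup linked (∈-lookup i)
  ; disjoint = cycle-disjoint cs un
  ; covers   = λ v → ∈-cycles⁻ cs (cov v)
  }
  where un = covering⇒unique (concatMap cycle cs) (proj₂ (Graph.finite G)) size cov

-- The end `y` is cut off, and `ys` is attached to the vertex `z` before it, of which only `R z y`
-- is known.
linked-append : ∀ {V : Set} {R : V → V → Set} {x y ys} xs → Linked R ((x ∷ xs) ∷ʳ y) →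
                (∀ {z} → R z y → Linked R (z ∷ ys)) → Linked R ((x ∷ xs) ++ ys)
linked-append []        (r ∷ _)  ext = ext r
linked-append (x′ ∷ xs) (r ∷ rs) ext = r ∷ linked-append xs rs ext

-- The graphs D(n) for n ≥ 8

module CyclicGraphs where

  -- Points (inj₁) and lines (inj₂) of the cyclic configuration without reduction modulo n.
  Code : Set
  Code = ℕ ⊎ ℕ

  Incident : Code → Code → Set
  Incident (inj₁ p) (inj₂ l) = p ∈ l ∷ 1 + l ∷ 3 + l ∷ []
  Incident (inj₂ l) (inj₁ p) = p ∈ l ∷ 1 + l ∷ 3 + l ∷ []
  Incident _        _        = ⊥

  open DecMembership _≟ⁿ_ using () renaming (_∈?_ to _∈ⁿ?_)
  open DecMembership (Sum.≡-dec _≟ⁿ_ _≟ⁿ_) using (_∈?_)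

  incident? : ∀ c d → Dec (Incident c d)
  incident? (inj₁ p) (inj₂ l) = p ∈ⁿ? _
  incident? (inj₂ l) (inj₁ p) = p ∈ⁿ? _
  incident? (inj₁ _) (inj₁ _) = no λ ()
  incident? (inj₂ _) (inj₂ _) = no λ ()

  raise : ℕ → Code → Code
  raise p = Sum.map (_+ p) (_+ p)

  -- A path from `start` to `raise period start`, without the latter.
  record Pattern : Set where
    field
      period : ℕ
      start  : Code
      rest   : List Code
      linked : Linked Incident ((start ∷ rest) ∷ʳ raise period start)

    codes : List Code
    codes = start ∷ rest

  walk-end : ∀ p k a → k * p + (p + a) ≡ suc k * p + a
  walk-end p k a = trans (sym (+-assoc (k * p) p a)) (cong (_+ a) (+-comm (k * p) p))

  ∸-<ʳ : ∀ {x e q} → e ≤ x → x < q + e → x ∸ e < q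
  ∸-<ʳ {x} {e} {q} e≤x x<q+e = +-cancelʳ-< e _ _ (subst (_< q + e) (sym (m∸n+n≡m e≤x)) x<q+e)

  -- The interval from `a` to `k * p + a` is cut into `k` blocks of length `p`: `base` handles the
  -- first block and `step` drops it. This is the recursion of `walk`.
  range-induction : ∀ p (R : ℕ → ℕ → ℕ → Set) → (∀ k a {i} → i < p → R (suc k) a (i + a)) →
                    (∀ k a {x} → R k (p + a) x → R (suc k) a x) →
                    ∀ k a x → a ≤ x → x < k * p + a → R k a x
  range-induction p R base step zero    a x a≤x x<a = contradiction (<-≤-trans x<a a≤x) λ lt → <-irrefl refl lt
  range-induction p R base step (suc k) a x a≤x x<e with x <? p + a
  ... | yes x<p = subst (R (suc k) a) (m∸n+n≡m a≤x) (base k a (∸-<ʳ a≤x x<p))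
  ... | no  x≮p = step k a (range-induction p R base step k (p + a) x (≮⇒≥ x≮p)
                              (subst (x <_) (sym (walk-end p k a)) x<e))

  module _ (n : ℕ) .{{_ : NonZero n}} where
    open Graph (D n) using (Vertex; Adj)

    point line : ℕ → Vertex
    point a = inj₁ (a mod n)
    line  a = inj₂ (a mod n)

    shift : ℕ → Code → Vertex
    shift a = [ (λ i → point (i + a)) , (λ i → line (i + a)) ]

    toℕ-mod : ∀ a → toℕ (a mod n) ≡ a % n
    toℕ-mod a = toℕ-fromℕ< (m%n<n a n)

    mod-cong : ∀ {a b} → a % n ≡ b % n → a mod n ≡ b mod n
    mod-cong {a} {b} eq = toℕ-injective (trans (toℕ-mod a) (trans eq (sym (toℕ-mod b))))

    mod-wrap : ∀ i a → (i + (n + a)) mod n ≡ (i + a) mod n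
    mod-wrap i a = mod-cong (trans
      (cong (_% n) (trans (cong (i +_) (+-comm n a)) (sym (+-assoc i a n))))
      ([m+n]%n≡m%n (i + a) n))

    shift-wrap : ∀ a c → shift (n + a) c ≡ shift a c
    shift-wrap a (inj₁ i) = cong inj₁ (mod-wrap i a)
    shift-wrap a (inj₂ i) = cong inj₂ (mod-wrap i a)

    shift-raise : ∀ p a c → shift a (raise p c) ≡ shift (p + a) c
    shift-raise p a (inj₁ i) = cong point (+-assoc i p a)
    shift-raise p a (inj₂ i) = cong line (+-assoc i p a)

    %-absorb : ∀ a d → (d + a) % n ≡ (toℕ (a mod n) + d) % n
    %-absorb a d rewrite toℕ-mod a = begin
      (d + a) % n                   ≡⟨ cong (_% n) (+-comm d a) ⟩
      (a + d) % n                   ≡⟨ %-distribˡ-+ a d n ⟩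
      (a % n + d % n) % n           ≡⟨ cong (λ r → (r + d % n) % n) (sym (m%n%n≡m%n a n)) ⟩
      (a % n % n + d % n) % n       ≡⟨ sym (%-distribˡ-+ (a % n) d n) ⟩
      (a % n + d) % n               ∎
      where open ≡-Reasoning

    incident-shift : ∀ a {p l} → p ∈ l ∷ 1 + l ∷ 3 + l ∷ [] → Adj (point (p + a)) (line (l + a))
    incident-shift a {l = l} (here refl) =
      here (trans (toℕ-mod (l + a)) (trans (%-absorb (l + a) 0) (cong (_% n) (+-identityʳ _))))
    incident-shift a {l = l} (there (here refl)) =
      there (here (trans (toℕ-mod (1 + l + a)) (%-absorb (l + a) 1)))
    incident-shift a {l = l} (there (there (here refl))) =
      there (there (here (trans (toℕ-mod (3 + l + a)) (%-absorb (l + a) 3))))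

    -- Incidence of codes survives translation and reduction modulo `n`, so one evaluated check on
    -- codes serves all offsets and all `n`.
    adj-shift : ∀ a {c d} → Incident c d → Adj (shift a c) (shift a d)
    adj-shift a {inj₁ _} {inj₂ _} e = incident-shift a e
    adj-shift a {inj₂ _} {inj₁ _} e = incident-shift a e

    linked-shift : ∀ a {cs} → Linked Incident cs → Linked Adj (map (shift a) cs)
    linked-shift a ls = Linked.map⁺ (Linked.map (λ {c} {d} → adj-shift a {c} {d}) ls)

    linked-pattern : ∀ B a → let open Pattern B in
                     Linked Adj (map (shift a) codes ∷ʳ shift (period + a) start)
    linked-pattern B a = subst (λ v → Linked Adj (map (shift a) codes ∷ʳ v)) (shift-raise period a start)
      (subst (Linked Adj) (map-++ (shift a) codes _) (linked-shift a linked))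
      where open Pattern B

    walk : Pattern → ℕ → ℕ → List Vertex
    walk B zero    a = []
    walk B (suc k) a = map (shift a) (Pattern.codes B) ++ walk B k (Pattern.period B + a)

    length-walk : ∀ B k a → length (walk B k a) ≡ k * length (Pattern.codes B)
    length-walk B zero    a = refl
    length-walk B (suc k) a = trans (length-++ (map (shift a) codes))
      (cong₂ _+_ (length-map (shift a) codes) (length-walk B k (period + a)))
      where open Pattern B

    linked-walk : ∀ B k a {v z} → let open Pattern B in v ≡ shift (k * period + a) start →
                  Adj z (shift a start) → Linked Adj (z ∷ walk B k a ++ v ∷ [])
    linked-walk B zero    a refl r = r ∷ [-]
    linked-walk B (suc k) a {v} {z} refl r = subst (λ ys → Linked Adj (z ∷ ys))
      (sym (++-assoc (map (shift a) codes) (walk B k (period + a)) (v ∷ [])))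
      (linked-append (map (shift a) codes) (r ∷ linked-pattern B a)
        (linked-walk B k (period + a) (cong (λ e → shift e start) (sym (walk-end period k a)))))
      where open Pattern B

    -- The circuit runs through `k` copies of `B` from offset `a`, then through one copy of `A`. It
    -- is listed from `A` on, so that it has a first vertex even for `k = 0`.
    round : Pattern → Pattern → ℕ → ℕ → Vertex × List Vertex
    round A B k a = shift e (Pattern.start A) , map (shift e) (Pattern.rest A) ++ walk B k a
      where e = k * Pattern.period B + a

    linked-round : ∀ A B k a → Pattern.start A ≡ Pattern.start B → Pattern.period A + k * Pattern.period B ≡ n →
                   Linked Adj (cycle (round A B k a) ∷ʳ proj₁ (round A B k a))
    linked-round A B k a refl eq =
      subst (Linked Adj) (sym (++-assoc (map (shift e) A.codes) (walk B k a) _))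
        (linked-append (map (shift e) A.rest) (linked-pattern A e)
          (λ {z} r → linked-walk B k a refl (subst (Adj z) wrap r)))
      where
      module A = Pattern A
      module B = Pattern B
      e = k * B.period + a
      -- The copy of `A` ends at offset `n + a`, which modulo `n` is the offset `a` where the copies
      -- of `B` begin.
      wrap : shift (A.period + e) A.start ≡ shift a A.start
      wrap = trans
        (cong (λ e → shift e A.start) (trans (sym (+-assoc A.period _ a)) (cong (_+ a) eq)))
        (shift-wrap a A.start)

    cyclicPartition : ∀ cs →
      All (λ c → 2 ≤ length (proj₂ c)) cs →
      All (λ c → Linked Adj (cycle c ∷ʳ proj₁ c)) cs →
      length (concatMap cycle cs) ≡ n + n →
      (∀ x → x < n → point (suc x) ∈ concatMap cycle cs × line x ∈ concatMap cycle cs) →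
      CircuitPartition (D n) (length cs)
    cyclicPartition cs long linked size cov = coveringPartition cs long linked size λ
      { (inj₁ i) → subst (_∈ concatMap cycle cs) (cong inj₁ (reduce i)) (points (toℕ i) (toℕ<n i))
      ; (inj₂ i) → subst (_∈ concatMap cycle cs) (cong inj₂ (reduce i)) (proj₂ (cov (toℕ i) (toℕ<n i))) }
      where
      reduce : ∀ i → toℕ i mod n ≡ i
      reduce i = toℕ-injective (trans (toℕ-mod (toℕ i)) (m<n⇒m%n≡m (toℕ<n i)))
      points : ∀ x → x < n → point x ∈ concatMap cycle cs
      points (suc x) lt = proj₁ (cov x (<-trans (n<1+n x) lt))
      points zero    lt = last n refl
        where
        last : ∀ m → m ≡ n → point 0 ∈ concatMap cycle cs
        last zero    eq = contradiction lt (subst (λ m → ¬ 0 < m) eq λ ())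
        last (suc m) eq = subst (_∈ concatMap cycle cs)
          (trans (cong point (trans eq (sym (+-identityʳ n)))) (shift-wrap 0 (inj₁ 0)))
          (proj₁ (cov m (subst (m <_) eq (n<1+n m))))

    shiftCycle : ℕ → Code × List Code → Vertex × List Vertex
    shiftCycle e (f , c) = shift e f , map (shift e) c

    concatMap-shiftCycle : ∀ e cs → concatMap cycle (map (shiftCycle e) cs) ≡ map (shift e) (concatMap cycle cs)
    concatMap-shiftCycle e []       = refl
    concatMap-shiftCycle e (c ∷ cs) = trans (cong (map (shift e) (cycle c) ++_) (concatMap-shiftCycle e cs))
                                            (sym (map-++ (shift e) (cycle c) (concatMap cycle cs)))

  -- Since `cs` has length `p + p` and contains these `p + p` different codes, it lists each exactly
  -- once: a fundamental domain for translation by `p`.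
  Full : ℕ → List Code → Set
  Full p cs = length cs ≡ p + p × (∀ (i : Fin p) → inj₁ (suc (toℕ i)) ∈ cs × inj₂ (toℕ i) ∈ cs)

  full? : ∀ p cs → Dec (Full p cs)
  full? p cs = length cs ≟ⁿ p + p ×-dec all? (λ i → inj₁ (suc (toℕ i)) ∈? cs ×-dec inj₂ (toℕ i) ∈? cs)

  ClosedCode : Code × List Code → Set
  ClosedCode c = 2 ≤ length (proj₂ c) × Linked Incident (cycle c ∷ʳ proj₁ c)

  closedCode? : ∀ c → Dec (ClosedCode c)
  closedCode? c = 2 ≤? length (proj₂ c) ×-dec linked? incident? (cycle c ∷ʳ proj₁ c)

  -- The copies of `B` fill the positions below `k * period B`; the copy of `A` together with the
  -- loops, all shifted by this amount, fills the remaining `period A` positions up to `n`. The last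
  -- hypothesis ensures that the long circuit has at least three vertices.
  roundPartition : ∀ A B loops → let open Pattern in
    start A ≡ start B → Full (period B) (codes B) → Full (period A) (codes A ++ concatMap cycle loops) →
    All ClosedCode loops → ∀ k n .{{_ : NonZero n}} → period A + k * period B ≡ n →
    2 ≤ length (rest A) + k →
    CircuitPartition (D n) (suc (length loops))
  roundPartition A B loops same fullB fullA closed k n eq enough = subst (CircuitPartition (D n))
    (cong suc (length-map (shiftCycle n e) loops))
    (cyclicPartition n cs
      (long ∷ All.map⁺ (All.map
        (λ {c} h → subst (2 ≤_) (sym (length-map (shift n e) (proj₂ c))) (proj₁ h)) closed))
      (linked-round n A B k 0 same eq ∷ All.map⁺ (All.map
        (λ {c} h → subst (Linked _) (map-++ (shift n e) (cycle c) _) (linked-shift n e (proj₂ h))) closed))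
      size cover)
    where
    module A = Pattern A
    module B = Pattern B
    e = k * B.period + 0
    tail = A.codes ++ concatMap cycle loops
    cs = round n A B k 0 ∷ map (shiftCycle n e) loops

    w = walk n B k 0

    length-w : length w ≡ k * suc (length B.rest)
    length-w = length-walk n B k 0

    long : 2 ≤ length (map (shift n e) A.rest ++ w)
    long = ≤-trans enough (≤-trans (+-monoʳ-≤ (length A.rest) (m≤m*n k (suc (length B.rest))))
      (≤-reflexive (sym (trans (length-++ (map (shift n e) A.rest))
                               (cong₂ _+_ (length-map (shift n e) A.rest) length-w)))))

    size : length (concatMap cycle cs) ≡ n + n
    size = begin
      length (concatMap cycle cs)
        ≡⟨ length-++ (cycle (round n A B k 0)) ⟩
      length (map (shift n e) A.codes ++ w) + length (concatMap cycle (map (shiftCycle n e) loops))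
        ≡⟨ cong₂ _+_
             (trans (length-++ (map (shift n e) A.codes))
                    (cong₂ _+_ (length-map (shift n e) A.codes) (trans length-w (cong (k *_) (proj₁ fullB)))))
             (trans (cong length (concatMap-shiftCycle n e loops))
                    (length-map (shift n e) (concatMap cycle loops))) ⟩
      (length A.codes + k * (B.period + B.period)) + length (concatMap cycle loops)
        ≡⟨ solve 3 (λ a b c → (a :+ b) :+ c := (a :+ c) :+ b) refl (length A.codes) _ _ ⟩
      (length A.codes + length (concatMap cycle loops)) + k * (B.period + B.period)
        ≡⟨ cong (_+ k * (B.period + B.period)) (trans (sym (length-++ A.codes)) (proj₁ fullA)) ⟩
      (A.period + A.period) + k * (B.period + B.period)
        ≡⟨ solve 3 (λ q k p → (q :+ q) :+ k :* (p :+ p) := (q :+ k :* p) :+ (q :+ k :* p)) refl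
             A.period k B.period ⟩
      (A.period + k * B.period) + (A.period + k * B.period)
        ≡⟨ cong₂ _+_ eq eq ⟩
      n + n ∎
      where
      open ≡-Reasoning
      open +-*-Solver

    in-tail : ∀ {c} → c ∈ tail → shift n e c ∈ concatMap cycle cs
    in-tail {c} p = [ ∈-++⁺ˡ ∘ ∈-++⁺ˡ ∘ ∈-map⁺ (shift n e)
                , ∈-++⁺ʳ (cycle (round n A B k 0))
                  ∘ subst (shift n e c ∈_) (sym (concatMap-shiftCycle n e loops))
                  ∘ ∈-map⁺ (shift n e)
                ]′ (∈-++⁻ A.codes p)

    in-walk : ∀ {v} → v ∈ w → v ∈ concatMap cycle cs
    in-walk = ∈-++⁺ˡ ∘ ∈-++⁺ʳ (map (shift n e) A.codes)

    In : List (Graph.Vertex (D n)) → ℕ → Set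
    In vs x = point n (suc x) ∈ vs × line n x ∈ vs

    walk-full : ∀ {p i} (a : ℕ) → Full p B.codes → i < p → In (map (shift n a) B.codes) (i + a)
    walk-full {p} {i} a (_ , full) i<p with full (fromℕ< i<p)
    ... | p∈ , l∈ rewrite toℕ-fromℕ< i<p = ∈-map⁺ (shift n a) p∈ , ∈-map⁺ (shift n a) l∈

    walk-cover : ∀ x → x < e → In w x
    walk-cover x x<e = range-induction B.period (λ k a x → In (walk n B k a) x)
      (λ k a lt → let p , l = walk-full a fullB lt in ∈-++⁺ˡ p , ∈-++⁺ˡ l)
      (λ k a (p , l) → ∈-++⁺ʳ (map (shift n a) B.codes) p , ∈-++⁺ʳ (map (shift n a) B.codes) l)
      k 0 x z≤n x<e

    cover : ∀ x → x < n → In (concatMap cycle cs) x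
    cover x x<n with x <? e
    ... | yes x<e = let p , l = walk-cover x x<e in in-walk p , in-walk l
    ... | no  x≮e = subst (In (concatMap cycle cs)) (m∸n+n≡m (≮⇒≥ x≮e)) (here-tail (x ∸ e)
          (∸-<ʳ (≮⇒≥ x≮e) (subst (x <_) (trans (sym eq) (cong (A.period +_) (sym (+-identityʳ _)))) x<n)))
      where
      here-tail : ∀ i → i < A.period → In (concatMap cycle cs) (i + e)
      here-tail i lt with proj₂ fullA (fromℕ< lt)
      ... | p∈ , l∈ rewrite toℕ-fromℕ< lt = in-tail p∈ , in-tail l∈

  checkedPattern : ∀ p s r → {True (linked? incident? ((s ∷ r) ∷ʳ raise p s))} → Pattern
  checkedPattern p s r {ok} = record { period = p ; start = s ; rest = r ; linked = toWitness ok }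

  -- `stepOne` goes from line i through point i + 1 to line i + 1. `stepTwo` goes from point i + 1
  -- through line i to point i + 3 and so preserves the parity of i. `stepFour` visits everything in
  -- its block, `stepFive` and `stepEleven` only a part.
  stepOne stepTwo stepFour stepFive stepEleven : Pattern
  stepOne    = checkedPattern 1 (inj₂ 0) (inj₁ 1 ∷ [])
  stepTwo    = checkedPattern 2 (inj₁ 1) (inj₂ 0 ∷ [])
  stepFour   = checkedPattern 4 (inj₁ 1) (inj₂ 0 ∷ inj₁ 3 ∷ inj₂ 3 ∷ inj₁ 4 ∷ inj₂ 1 ∷ inj₁ 2 ∷ inj₂ 2 ∷ [])
  stepFive   = checkedPattern 5 (inj₁ 1) (inj₂ 0 ∷ inj₁ 3 ∷ inj₂ 3 ∷ [])
  stepEleven = checkedPattern 11 (inj₁ 1) (inj₂ 0 ∷ inj₁ 3 ∷ inj₂ 3 ∷ inj₁ 6 ∷ inj₂ 6 ∷ inj₁ 9 ∷ inj₂ 9 ∷ [])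

  -- In D(5+4k), stepFive and k copies of stepFour form a circuit that misses exactly the
  -- circuit loopFive; similarly for D(11+4k). The circuits were found by computer search.
  loopFive loopEleven : Code × List Code
  loopFive   = inj₁ 5 , inj₂ 4 ∷ inj₁ 4 ∷ inj₂ 1 ∷ inj₁ 2 ∷ inj₂ 2 ∷ []
  loopEleven = inj₁ 11 , inj₂ 10 ∷ inj₁ 10 ∷ inj₂ 7 ∷ inj₁ 7 ∷ inj₂ 4 ∷ inj₁ 4 ∷ inj₂ 1 ∷
               inj₁ 2 ∷ inj₂ 2 ∷ inj₁ 5 ∷ inj₂ 5 ∷ inj₁ 8 ∷ inj₂ 8 ∷ []

  hamiltonian : ∀ k → CircuitPartition (D (2 + k)) 1
  hamiltonian k = roundPartition stepOne stepOne [] refl full full [] (suc k) (2 + k)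
    (cong suc (*-identityʳ (suc k))) (s≤s (s≤s z≤n))
    where full = from-yes (full? 1 (Pattern.codes stepOne))

  partition-5+4k : ∀ k → CircuitPartition (D (5 + k * 4)) 2
  partition-5+4k k = roundPartition stepFive stepFour (loopFive ∷ []) refl
    (from-yes (full? 4 (Pattern.codes stepFour)))
    (from-yes (full? 5 (Pattern.codes stepFive ++ concatMap cycle (loopFive ∷ []))))
    (from-yes (closedCode? loopFive) ∷ []) k (5 + k * 4) refl (s≤s (s≤s z≤n))

  partition-11+4k : ∀ k → CircuitPartition (D (11 + k * 4)) 2
  partition-11+4k k = roundPartition stepEleven stepFour (loopEleven ∷ []) refl
    (from-yes (full? 4 (Pattern.codes stepFour)))
    (from-yes (full? 11 (Pattern.codes stepEleven ++ concatMap cycle (loopEleven ∷ []))))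
    (from-yes (closedCode? loopEleven) ∷ []) k (11 + k * 4) refl (s≤s (s≤s z≤n))

  -- As `n` is even, the rounds of `stepTwo` from the offsets 0 and 1 never meet. Each fills only
  -- half of every block, so covering is proved for both jointly and not through `roundPartition`.
  partition-4+2k : ∀ k → CircuitPartition (D (4 + k * 2)) 2
  partition-4+2k k = cyclicPartition n cs (s≤s (s≤s z≤n) ∷ s≤s (s≤s z≤n) ∷ [])
    (linked-round n stepTwo stepTwo (suc k) 0 refl refl ∷ linked-round n stepTwo stepTwo (suc k) 1 refl refl ∷ [])
    size cover
    where
    n = 4 + k * 2
    e = suc k * 2 + 0
    c₀ = round n stepTwo stepTwo (suc k) 0
    c₁ = round n stepTwo stepTwo (suc k) 1
    cs = c₀ ∷ c₁ ∷ []

    size : length (concatMap cycle cs) ≡ n + n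
    size = begin
      length (cycle c₀ ++ cycle c₁ ++ [])     ≡⟨ cong length (cong (cycle c₀ ++_) (++-identityʳ (cycle c₁))) ⟩
      length (cycle c₀ ++ cycle c₁)           ≡⟨ length-++ (cycle c₀) ⟩
      length (cycle c₀) + length (cycle c₁)   ≡⟨ cong₂ (λ a b → (2 + a) + (2 + b))
                                                   (length-walk n stepTwo (suc k) 0)
                                                   (length-walk n stepTwo (suc k) 1) ⟩
      n + n ∎
      where open ≡-Reasoning

    later : ∀ {v x y : Graph.Vertex (D n)} {vs} → v ∈ vs → v ∈ x ∷ y ∷ vs
    later p = there (there p)

    -- The two walks advance together: dropping the first copy of `stepTwo` from each raises both
    -- offsets by 2.
    Both : ℕ → ℕ → ℕ → Set
    Both j a x = (point n (suc x) ∈ walk n stepTwo j a ⊎ point n (suc x) ∈ walk n stepTwo j (suc a))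
               × (line n x ∈ walk n stepTwo j a ⊎ line n x ∈ walk n stepTwo j (suc a))

    base : ∀ j a {i} → i < 2 → Both (suc j) a (i + a)
    base j a {zero}        _ = inj₁ (here refl) , inj₁ (there (here refl))
    base j a {suc zero}    _ = inj₂ (here refl) , inj₂ (there (here refl))
    base j a {suc (suc _)} (s≤s (s≤s ()))

    step : ∀ j a {x} → Both j (2 + a) x → Both (suc j) a x
    step j a (p , l) = Sum.map later later p , Sum.map later later l

    both : ∀ {v} → v ∈ cycle c₀ ⊎ v ∈ cycle c₁ → v ∈ concatMap cycle cs
    both = [ ∈-++⁺ˡ , ∈-++⁺ʳ (cycle c₀) ∘ ∈-++⁺ˡ ]′

    last : ∀ i → i < 2 → point n (suc (i + e)) ∈ concatMap cycle cs × line n (i + e) ∈ concatMap cycle cs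
    last zero          _ = both (inj₁ (here refl)) , both (inj₁ (there (here refl)))
    -- The copy listed first in `c₁` has offset `suc k * 2 + 1`, which is `suc e`.
    last (suc zero)    _ = both (inj₂ (here (cong (point n ∘ suc) (sym (+-suc (suc k * 2) 0)))))
                         , both (inj₂ (there (here (cong (line n) (sym (+-suc (suc k * 2) 0))))))
    last (suc (suc _)) (s≤s (s≤s ()))

    cover : ∀ x → x < n → point n (suc x) ∈ concatMap cycle cs × line n x ∈ concatMap cycle cs
    cover x x<n with x <? e
    ... | yes x<e = let p , l = range-induction 2 Both base step (suc k) 0 x z≤n x<e in
                    both (Sum.map later later p) , both (Sum.map later later l)
    ... | no  x≮e = subst (λ x → point n (suc x) ∈ concatMap cycle cs × line n x ∈ concatMap cycle cs)
          (m∸n+n≡m (≮⇒≥ x≮e)) (last (x ∸ e) (∸-<ʳ (≮⇒≥ x≮e) (subst (x <_) (cong (2 +_) (sym (+-identityʳ _))) x<n)))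

  -- These forms exhaust `n ≥ 8`: they include 8, 9, 10, 11, and adding 4 preserves each. The class
  -- of 3 modulo 4 cannot start at 7, since the Heawood graph has no 2-factor with two circuits.
  data Residue : ℕ → Set where
    4+2k  : ∀ k → Residue (4 + k * 2)
    9+4k  : ∀ k → Residue (9 + k * 4)
    11+4k : ∀ k → Residue (11 + k * 4)

  residue : ∀ j → Residue (8 + j)
  residue 0 = 4+2k 2
  residue 1 = 9+4k 0
  residue 2 = 4+2k 3
  residue 3 = 11+4k 0
  residue (suc (suc (suc (suc j)))) = shift₄ (residue j)
    where
    shift₄ : ∀ {n} → Residue n → Residue (4 + n)
    shift₄ (4+2k k)  = 4+2k (2 + k)
    shift₄ (9+4k k)  = 9+4k (1 + k)
    shift₄ (11+4k k) = 11+4k (1 + k)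

  twoCircuits : ∀ {n} → Residue n → CircuitPartition (D n) 2
  twoCircuits (4+2k k)  = partition-4+2k k
  twoCircuits (9+4k k)  = partition-5+4k (1 + k)
  twoCircuits (11+4k k) = partition-11+4k k

  D-¬pseudo : ∀ j → ¬ PseudoTwoFactorIsomorphic (D (8 + j))
  D-¬pseudo j P = contradiction (partition-parity P (hamiltonian (6 + j)) (twoCircuits (residue j))) λ ()

-- The graphs T₁(n), T₂(n) and T₃(n)

module SegmentGraphs where

  open Segment using (SegmentVertex; u; w; x; y; z; v; t; ¹; ²; ³; segmentVertices; _≟ˢ_; segmentEdges; linkEdges;
                      closing₁; closing₂; closing₃; Loopless; loopless?; segment; link; close; T)
  open DecMembership _≟ˢ_ using (_∈?_)
  open DecMembership (Product.≡-dec _≟ˢ_ _≟ˢ_) using () renaming (_∈?_ to _∈ᵉ?_)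

  allSegmentVertices? : {P : SegmentVertex → Set} → Decidable P → Dec (∀ s → P s)
  allSegmentVertices? {P} P? = map′
    (λ h s → subst P (strictlyInverseʳ s) (h (φ s))) (λ h → h ∘ ψ) (all? (P? ∘ ψ))
    where open Inverse segmentVertices using (strictlyInverseʳ) renaming (to to φ; from to ψ)

  -- The part of a segment that is traversed together with the next segment.
  outPath : List SegmentVertex
  outPath = v ¹ ∷ t ² ∷ v ² ∷ z ² ∷ y ³ ∷ z ³ ∷ v ³ ∷ []

  inward : SegmentVertex → Bool
  inward s = not (does (s ∈? outPath))

  -- The Booleans tell whether the ends lie in the later of the two segments; `links` are directed
  -- from the earlier segment to the later one.
  Step : List (SegmentVertex × SegmentVertex) → Bool → Bool → SegmentVertex → SegmentVertex → Set
  Step links false true  r s = (r , s) ∈ links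
  Step links true  false r s = (s , r) ∈ links
  Step links _     _     r s = (r , s) ∈ segmentEdges ⊎ (s , r) ∈ segmentEdges

  step? : ∀ links a b r s → Dec (Step links a b r s)
  step? links false true  r s = (r , s) ∈ᵉ? links
  step? links true  false r s = (s , r) ∈ᵉ? links
  step? links false false r s = (r , s) ∈ᵉ? segmentEdges ⊎-dec (s , r) ∈ᵉ? segmentEdges
  step? links true  true  r s = (r , s) ∈ᵉ? segmentEdges ⊎-dec (s , r) ∈ᵉ? segmentEdges

  -- A circuit of which the inward vertices lie in one segment and the others in
  -- the preceding segment, where `links` joins the two segments.
  LocalCircuit : List (SegmentVertex × SegmentVertex) → SegmentVertex × List SegmentVertex → Set
  LocalCircuit links (f , c) =
      2 ≤ length c
    × Unique (f ∷ c)
    × Linked (λ r s → Step links (inward r) (inward s) r s) ((f ∷ c) ∷ʳ f)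

  localCircuit? : ∀ links c → Dec (LocalCircuit links c)
  localCircuit? links (f , c) =
          2 ≤? length c
    ×-dec unique? _≟ˢ_ (f ∷ c)
    ×-dec linked? (λ r s → step? links (inward r) (inward s) r s) ((f ∷ c) ∷ʳ f)

  _∈ᶜ_ : SegmentVertex → SegmentVertex × List SegmentVertex → Set
  s ∈ᶜ (f , c) = s ∈ f ∷ c

  _∈ᶜ?_ : ∀ s c → Dec (s ∈ᶜ c)
  s ∈ᶜ? (f , c) = s ∈? (f ∷ c)

  module _ (closing : List (SegmentVertex × SegmentVertex)) (ok : Loopless closing) (m : ℕ) where
    private
      G = T closing ok (suc m)

    open Graph G using (Vertex; Adj)

    previous : Fin (suc m) → Fin (suc m)
    previous zero    = fromℕ m
    previous (suc i) = inject₁ i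

    previous-injective : ∀ {i j} → previous i ≡ previous j → i ≡ j
    previous-injective {zero}  {zero}  eq = refl
    previous-injective {zero}  {suc j} eq = contradiction eq fromℕ≢inject₁
    previous-injective {suc i} {zero}  eq = contradiction (sym eq) fromℕ≢inject₁
    previous-injective {suc i} {suc j} eq = cong suc (inject₁-injective eq)

    previous-surjective : ∀ i → ∃ λ j → previous j ≡ i
    previous-surjective i with view i
    ... | ‵fromℕ     = zero , refl
    ... | ‵inject₁ j = suc j , refl

    linksInto : Fin (suc m) → List (SegmentVertex × SegmentVertex)
    linksInto zero    = closing
    linksInto (suc _) = linkEdges

    -- The segment that holds the inward or the other vertices of a circuit with index `i`. For
    -- `m = 0` both are the same segment, which `closing` joins to itself.
    home : Fin (suc m) → Bool → Fin (suc m)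
    home i true  = i
    home i false = previous i

    home-injective : ∀ b {i j} → home i b ≡ home j b → i ≡ j
    home-injective true  eq = eq
    home-injective false eq = previous-injective eq

    home-surjective : ∀ b i → ∃ λ j → home j b ≡ i
    home-surjective true  i = i , refl
    home-surjective false i = previous-surjective i

    place : Fin (suc m) → SegmentVertex → Vertex
    place i s = home i (inward s) , s

    crossing : ∀ i {r s} → (r , s) ∈ linksInto i → Adj (previous i , r) (i , s)
    crossing zero    e = fwd (close (cong suc (toℕ-fromℕ m)) refl e)
    crossing (suc i) e = fwd (link (cong suc (toℕ-inject₁ i)) e)

    step-adj : ∀ i a b {r s} → Step (linksInto i) a b r s → Adj (home i a , r) (home i b , s)
    step-adj i false true  e        = crossing i e
    step-adj i true  false e        = Graph.adj-sym G (crossing i e)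
    step-adj i true  true  (inj₁ e) = fwd (segment e)
    step-adj i true  true  (inj₂ e) = bwd (segment e)
    step-adj i false false (inj₁ e) = fwd (segment e)
    step-adj i false false (inj₂ e) = bwd (segment e)

    module _ {k : ℕ} (seg : Fin k → Fin (suc m)) (code : Fin k → SegmentVertex × List SegmentVertex)
             (local : ∀ j → LocalCircuit (linksInto (seg j)) (code j))
             (separated : ∀ j j′ {s} → seg j ≡ seg j′ → s ∈ᶜ code j → s ∈ᶜ code j′ → j ≡ j′)
             (exhaustive : ∀ i s → ∃ λ j → seg j ≡ i × s ∈ᶜ code j) where

      -- For each fixed `s`, `home` permutes the segments. Hence disjointness and covering can be
      -- tested index by index, as if all vertices of a circuit with index `i` were in segment `i`.
      localPartition : CircuitPartition G k
      localPartition = record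
        { first    = λ j → place (seg j) (proj₁ (code j))
        ; rest     = λ j → map (place (seg j)) (proj₂ (code j))
        ; long     = λ j → subst (2 ≤_) (sym (length-map (place (seg j)) (proj₂ (code j)))) (proj₁ (local j))
        ; simple   = λ j → Unique.map⁺ (cong proj₂) (proj₁ (proj₂ (local j)))
        ; linked   = λ j → subst (Linked Adj) (map-++ (place (seg j)) (proj₁ (code j) ∷ proj₂ (code j)) _)
                       (Linked.map⁺ (Linked.map (step-adj (seg j) _ _) (proj₂ (proj₂ (local j)))))
        ; disjoint = λ j j′ p q → disjoint j j′ (∈-map⁻ (place (seg j)) p) (∈-map⁻ (place (seg j′)) q)
        ; covers   = λ (i , s) → covers i s (home-surjective (inward s) i)
        }
        where
        disjoint : ∀ {p} j j′ → (∃ λ s → s ∈ᶜ code j × p ≡ place (seg j) s) →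
                   (∃ λ s → s ∈ᶜ code j′ × p ≡ place (seg j′) s) → j ≡ j′
        disjoint j j′ (s , s∈ , refl) (s′ , s′∈ , eq) with refl ← cong proj₂ eq =
          separated j j′ (home-injective (inward s) (cong proj₁ eq)) s∈ s′∈
        covers : ∀ i s → (∃ λ i′ → home i′ (inward s) ≡ i) →
                 ∃ λ j → (i , s) ∈ map (place (seg j)) (proj₁ (code j) ∷ proj₂ (code j))
        covers i s (i′ , refl) with j , refl , s∈ ← exhaustive i′ s = j , ∈-map⁺ (place (seg j)) s∈

  -- The prefix is `outPath`, which meets the next segment at its ends `v ¹` and `v ³`. So `c` has
  -- to run, in that segment, from the vertex linked to `v ³` to the one linked to `v ¹`.
  throughLink : List SegmentVertex → SegmentVertex × List SegmentVertex
  throughLink c = v ¹ , t ² ∷ v ² ∷ z ² ∷ y ³ ∷ z ³ ∷ v ³ ∷ c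

  linkCircuit : SegmentVertex × List SegmentVertex
  linkCircuit = throughLink (u ³ ∷ w ² ∷ x ² ∷ y ² ∷ z ¹ ∷ y ¹ ∷ x ¹ ∷ t ¹ ∷ x ³ ∷ w ³ ∷ u ² ∷ w ¹ ∷ u ¹ ∷ [])

  linkCircuit-local : LocalCircuit linkEdges linkCircuit
  linkCircuit-local = from-yes (localCircuit? linkEdges linkCircuit)

  ∈-linkCircuit : ∀ s → s ∈ᶜ linkCircuit
  ∈-linkCircuit = from-yes (allSegmentVertices? (_∈ᶜ? linkCircuit))

  -- Two ways to treat the last and the first segment: by one circuit, or by two circuits
  -- of which `loop` stays in the first segment.
  Switch : List (SegmentVertex × SegmentVertex) → (long short loop : SegmentVertex × List SegmentVertex) → Set
  Switch closing long short loop =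
      LocalCircuit closing long
    × (∀ s → s ∈ᶜ long)
    × LocalCircuit closing short
    × LocalCircuit closing loop
    × (∀ s → ¬ (s ∈ᶜ short × s ∈ᶜ loop))
    × (∀ s → s ∈ᶜ short ⊎ s ∈ᶜ loop)

  switch? : ∀ closing long short loop → Dec (Switch closing long short loop)
  switch? closing long short loop =
          localCircuit? closing long
    ×-dec allSegmentVertices? (_∈ᶜ? long)
    ×-dec localCircuit? closing short
    ×-dec localCircuit? closing loop
    ×-dec allSegmentVertices? (λ s → ¬? (s ∈ᶜ? short ×-dec s ∈ᶜ? loop))
    ×-dec allSegmentVertices? (λ s → s ∈ᶜ? short ⊎-dec s ∈ᶜ? loop)

  -- The two partitions differ only in the circuits entering segment zero: `long` alone, or `short`
  -- and `loop`. They have `m + 1` and `m + 2` circuits.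
  switch⇒¬pseudo : ∀ {closing long short loop} → Switch closing long short loop →
                   ∀ ok m → ¬ PseudoTwoFactorIsomorphic (T closing ok (suc m))
  switch⇒¬pseudo {closing} {long} {short} {loop} (long-local , ∈-long , short-local , loop-local , apart , ∈-short⊎loop) ok m P =
    parity-alternates (suc m) (partition-parity P
      (localPartition closing ok m id code local (λ _ _ eq _ _ → eq) (λ i s → i , refl , exhaustive i s))
      (localPartition closing ok m seg′ code′ local′ separated′ exhaustive′))
    where
    code : Fin (suc m) → SegmentVertex × List SegmentVertex
    code zero    = long
    code (suc _) = linkCircuit

    local : ∀ j → LocalCircuit (linksInto closing ok m j) (code j)
    local zero    = long-local
    local (suc _) = linkCircuit-local

    exhaustive : ∀ i s → s ∈ᶜ code i
    exhaustive zero    = ∈-long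
    exhaustive (suc _) = ∈-linkCircuit

    -- Index zero is the additional `loop`; it shares segment zero with `short`, while the other
    -- indices are those of the first partition moved up by one.
    seg′ : Fin (suc (suc m)) → Fin (suc m)
    seg′ zero    = zero
    seg′ (suc i) = i

    code′ : Fin (suc (suc m)) → SegmentVertex × List SegmentVertex
    code′ zero          = loop
    code′ (suc zero)    = short
    code′ (suc (suc _)) = linkCircuit

    local′ : ∀ j → LocalCircuit (linksInto closing ok m (seg′ j)) (code′ j)
    local′ zero          = loop-local
    local′ (suc zero)    = short-local
    local′ (suc (suc _)) = linkCircuit-local

    separated′ : ∀ j j′ {s} → seg′ j ≡ seg′ j′ → s ∈ᶜ code′ j → s ∈ᶜ code′ j′ → j ≡ j′
    separated′ zero       zero        eq   p q = refl
    separated′ zero       (suc zero)  refl p q = contradiction (q , p) (apart _)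
    separated′ (suc zero) zero        refl p q = contradiction (p , q) (apart _)
    separated′ (suc i)    (suc j)     eq   p q = cong suc eq

    exhaustive′ : ∀ i s → ∃ λ j → seg′ j ≡ i × s ∈ᶜ code′ j
    exhaustive′ zero    s = [ (λ p → suc zero , refl , p) , (λ p → zero , refl , p) ]′ (∈-short⊎loop s)
    exhaustive′ (suc i) s = suc (suc i) , refl , ∈-linkCircuit s


  -- `closing₁` equals `linkEdges`, so `linkCircuit` serves as the long circuit. For `closing₂` and
  -- `closing₃` the inward path has to run from `u ¹` to `u ³` and from `u ¹` to `u ²`. In all three
  -- cases `short` keeps three inward vertices and `loop` takes the other ten.
  switch₁ : Switch closing₁ _ _ _
  switch₁ = from-yes (switch? closing₁ linkCircuit
    (throughLink (u ³ ∷ w ² ∷ u ¹ ∷ []))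
    (t ¹ , x ² ∷ y ² ∷ z ¹ ∷ y ¹ ∷ x ¹ ∷ w ¹ ∷ u ² ∷ w ³ ∷ x ³ ∷ []))

  switch₂ : Switch closing₂ _ _ _
  switch₂ = from-yes (switch? closing₂
    (throughLink (u ¹ ∷ w ¹ ∷ u ² ∷ w ³ ∷ x ³ ∷ t ¹ ∷ x ¹ ∷ y ¹ ∷ z ¹ ∷ y ² ∷ x ² ∷ w ² ∷ u ³ ∷ []))
    (throughLink (u ¹ ∷ w ² ∷ u ³ ∷ []))
    (t ¹ , x ² ∷ y ² ∷ z ¹ ∷ y ¹ ∷ x ¹ ∷ w ¹ ∷ u ² ∷ w ³ ∷ x ³ ∷ []))

  switch₃ : Switch closing₃ _ _ _
  switch₃ = from-yes (switch? closing₃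
    (throughLink (u ¹ ∷ w ² ∷ u ³ ∷ w ³ ∷ x ³ ∷ t ¹ ∷ x ² ∷ y ² ∷ z ¹ ∷ y ¹ ∷ x ¹ ∷ w ¹ ∷ u ² ∷ []))
    (throughLink (u ¹ ∷ w ¹ ∷ u ² ∷ []))
    (t ¹ , x ¹ ∷ y ¹ ∷ z ¹ ∷ y ² ∷ x ² ∷ w ² ∷ u ³ ∷ w ³ ∷ x ³ ∷ []))

  T₁-¬pseudo : ∀ m → ¬ PseudoTwoFactorIsomorphic (T₁ (suc m))
  T₁-¬pseudo = switch⇒¬pseudo switch₁ (from-yes (loopless? closing₁))

  T₂-¬pseudo : ∀ m → ¬ PseudoTwoFactorIsomorphic (T₂ (suc m))
  T₂-¬pseudo = switch⇒¬pseudo switch₂ (from-yes (loopless? closing₂))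

  T₃-¬pseudo : ∀ m → ¬ PseudoTwoFactorIsomorphic (T₃ (suc m))
  T₃-¬pseudo = switch⇒¬pseudo switch₃ (from-yes (loopless? closing₃))

-- Circuits of a 2-factor as its connected components

lookup-injective : ∀ {A : Set} {xs : List A} → Unique xs → ∀ {i j} → lookup xs i ≡ lookup xs j → i ≡ j
lookup-injective (_ ∷ _)     {zero}  {zero}  eq = refl
lookup-injective (h ∷ un) {zero}  {suc j} eq = contradiction eq (All.lookup h (∈-lookup j))
lookup-injective (h ∷ un) {suc i} {zero}  eq = contradiction (sym eq) (All.lookup h (∈-lookup i))
lookup-injective (h ∷ un) {suc i} {suc j} eq = cong suc (lookup-injective un eq)

linked⇒star : ∀ {V : Set} {R : V → V → Set} {x xs y} → Linked R (x ∷ xs) → y ∈ x ∷ xs → Star R x y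
linked⇒star _        (here refl)         = ε
linked⇒star (r ∷ rs) (there p@(here _))  = r ◅ linked⇒star rs p
linked⇒star (r ∷ rs) (there p@(there _)) = r ◅ linked⇒star rs p

module Component {G : Graph} {F : TwoFactor G} {k : ℕ} (D : IsDisjointUnionOfCircuits F k) where
  open Graph G using (Vertex)
  open TwoFactor F using (E; E-sym)
  open IsDisjointUnionOfCircuits D

  component : Vertex → Fin k
  component v = proj₁ (covers-V v)

  private
    module C i = Circuit (circuit i)

    on-walk : ∀ i {v} → v ∈ C.closedWalk i → component v ≡ i
    on-walk i {v} p = disjoint _ i (proj₂ (covers-V v))
      ([ id , (λ { (here refl) → here refl }) ]′ (∈-++⁻ (C.vertices i) p))

    traverses : ∀ i {u v} → C.Traverses i u v → component u ≡ component v
    traverses i {u} {v} (ys , zs , eq) = trans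
      (on-walk i (subst (u ∈_) (sym eq) (∈-++⁺ʳ ys (here refl))))
      (sym (on-walk i (subst (v ∈_) (sym eq) (∈-++⁺ʳ ys (there (here refl))))))

    from-first : ∀ v → Star E (C.first (component v)) v
    from-first v = linked⇒star (C.linked (component v)) (∈-++⁺ˡ (proj₂ (covers-V v)))

  component-edge : ∀ {u v} → E u v → component u ≡ component v
  component-edge e with covers-E e
  ... | i , fwd t = traverses i t
  ... | i , bwd t = sym (traverses i t)

  -- Both vertices are reached from the first vertex of their common circuit.
  component-connected : ∀ {u v} → component u ≡ component v → Star E u v
  component-connected {u} {v} eq =
    reverse E-sym (from-first u) ◅◅ subst (λ i → Star E (C.first i) v) (sym eq) (from-first v)

  representative : Fin k → Vertex
  representative = C.first

  component-representative : ∀ i → component (representative i) ≡ i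
  component-representative i = on-walk i (here refl)

  component-star : ∀ {u v} → Star E u v → component u ≡ component v
  component-star ε        = refl
  component-star (e ◅ es) = trans (component-edge e) (component-star es)

-- Counting connected components by merging labels

module Labelling {V : Set} (_≟_ : DecidableEquality V) where

  -- A labelling of the vertices is a list of pairs (vertex, label) rather than
  -- a function so that evaluation shares the labels.
  Labels : Set
  Labels = List (V × V)

  label : Labels → V → V
  label []             v = v
  label ((u , a) ∷ ls) v = if does (v ≟ u) then a else label ls v

  replace : V → V → V → V
  replace a b c = if does (c ≟ a) then b else c

  -- The union step of a union-find: the class of `x` takes over the label of `y`.
  merge : Labels → V × V → Labels
  merge ls (x , y) = map (map₂ (replace (label ls x) (label ls y))) ls

  labels : List V → List (V × V) → Labels
  labels vs = foldl merge (map (λ v → v , v) vs)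

  -- After all merges a label is a vertex of its own class, so every class has exactly one vertex
  -- labelled by itself.
  fixedPoints : List V → Labels → List V
  fixedPoints vs ls = filter (λ v → label ls v ≟ v) vs

  components : List V → List (V × V) → ℕ
  components vs es = length (fixedPoints vs (labels vs es))

  -- For a vertex without an entry, `label` falls back to the vertex itself, and `merge` would not
  -- rename it.
  Total : Labels → Set
  Total ls = ∀ v → Any (λ p → v ≡ proj₁ p) ls

  merge-total : ∀ {ls} e → Total ls → Total (merge ls e)
  merge-total e tot v = Any.map⁺ (tot v)

  label-merge : ∀ {ls} x y → Total ls → ∀ v →
                label (merge ls (x , y)) v ≡ replace (label ls x) (label ls y) (label ls v)
  label-merge {ls} x y tot v = go (tot v)
    where
    f = replace (label ls x) (label ls y)
    go : ∀ {ls} → Any (λ p → v ≡ proj₁ p) ls → label (map (map₂ f) ls) v ≡ f (label ls v)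
    go {(u , _) ∷ _} p with v ≟ u | p
    ... | yes _  | _       = refl
    ... | no v≢u | here eq = contradiction eq v≢u
    ... | no _   | there q = go q

  label-initial : ∀ vs v → label (map (λ v → v , v) vs) v ≡ v
  label-initial []       v = refl
  label-initial (u ∷ vs) v with v ≟ u
  ... | yes eq = sym eq
  ... | no _   = label-initial vs v

  module _ {E : V → V → Set} (E-sym : Symmetric E) where

    -- A relabelled vertex `v` is joined to its new label by way of the label of `x`, then `x`, then
    -- `y`.
    merge-connected : ∀ {ls x y} → Total ls → E x y → (∀ v → Star E v (label ls v)) →
                      ∀ v → Star E v (label (merge ls (x , y)) v)
    merge-connected {ls} {x} {y} tot e con v rewrite label-merge x y tot v with label ls v ≟ label ls x
    ... | yes eq = subst (Star E v) eq (con v) ◅◅ reverse E-sym (con x) ◅◅ e ◅ con y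
    ... | no _   = con v

    foldl-connected : ∀ {ls es} → Total ls → All (λ e → E (proj₁ e) (proj₂ e)) es →
                      (∀ v → Star E v (label ls v)) → ∀ v → Star E v (label (foldl merge ls es) v)
    foldl-connected tot []       con = con
    foldl-connected tot (p ∷ ps) con = foldl-connected (merge-total _ tot) ps (merge-connected tot p con)

  merge-resp : ∀ {ls u v} e → Total ls → label ls u ≡ label ls v → label (merge ls e) u ≡ label (merge ls e) v
  merge-resp {ls} {u} {v} (x , y) tot eq = trans (label-merge x y tot u) (trans
    (cong (replace (label ls x) (label ls y)) eq) (sym (label-merge x y tot v)))

  merge-edge : ∀ {ls} x y → Total ls → label (merge ls (x , y)) x ≡ label (merge ls (x , y)) y
  merge-edge {ls} x y tot = trans (label-merge x y tot x) (trans replaced (sym (label-merge x y tot y)))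
    where
    replaced : replace (label ls x) (label ls y) (label ls x) ≡ replace (label ls x) (label ls y) (label ls y)
    replaced with label ls x ≟ label ls x | label ls y ≟ label ls x
    ... | yes _ | yes _ = refl
    ... | yes _ | no _  = refl
    ... | no ¬p | _     = contradiction refl ¬p

  foldl-resp : ∀ {ls u v} es → Total ls → label ls u ≡ label ls v →
               label (foldl merge ls es) u ≡ label (foldl merge ls es) v
  foldl-resp []       tot eq = eq
  foldl-resp (e ∷ es) tot eq = foldl-resp es (merge-total e tot) (merge-resp e tot eq)

  foldl-edge : ∀ {ls u v es} → Total ls → (u , v) ∈ es →
               label (foldl merge ls es) u ≡ label (foldl merge ls es) v
  foldl-edge {es = e ∷ es} tot (here refl) = foldl-resp es (merge-total e tot) (merge-edge _ _ tot)
  foldl-edge {es = e ∷ es} tot (there p)   = foldl-edge (merge-total e tot) p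

module _ {G : Graph} (_≟_ : DecidableEquality (Graph.Vertex G)) {F : TwoFactor G} {k : ℕ}
         (D : IsDisjointUnionOfCircuits F k) where
  open Graph G using (Vertex)
  open TwoFactor F using (E; E-sym)
  open Component D
  open Labelling _≟_

  -- Both numbers count the components of `E`. A circuit is sent to the label of its first vertex,
  -- and a vertex labelled by itself to its circuit; both maps are injective.
  circuits≡components : ∀ {vs es} → Unique vs → (∀ v → v ∈ vs) →
    All (λ e → E (proj₁ e) (proj₂ e)) es → (∀ {u v} → E u v → (u , v) ∈ es ⊎ (v , u) ∈ es) →
    k ≡ components vs es
  circuits≡components {vs} {es} un all∈ sound complete =
    cantor-schröder-bernstein {f = f} {g = g} f-injective g-injective
    where
    l : Vertex → Vertex
    l = label (labels vs es)

    total : Total (map (λ v → v , v) vs)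
    total v = Any.map⁺ (all∈ v)

    l-connected : ∀ v → Star E v (l v)
    l-connected = foldl-connected E-sym total sound λ v → subst (Star E v) (sym (label-initial vs v)) ε

    l-edge : ∀ {u v} → E u v → l u ≡ l v
    l-edge e = [ foldl-edge total , sym ∘ foldl-edge total ]′ (complete e)

    l-star : ∀ {u v} → Star E u v → l u ≡ l v
    l-star ε        = refl
    l-star (e ◅ es) = trans (l-edge e) (l-star es)

    l-idem : ∀ v → l (l v) ≡ l v
    l-idem v = sym (l-star (l-connected v))

    fixed? : ∀ v → Dec (l v ≡ v)
    fixed? v = l v ≟ v

    R : List Vertex
    R = fixedPoints vs (labels vs es)

    mem : ∀ i → l (representative i) ∈ R
    mem i = ∈-filter⁺ fixed? (all∈ _) (l-idem _)

    f : Fin k → Fin (length R)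
    f i = index (mem i)

    g : Fin (length R) → Fin k
    g j = component (lookup R j)

    component-l : ∀ v → component (l v) ≡ component v
    component-l v = sym (component-star (l-connected v))

    f-injective : ∀ {i j} → f i ≡ f j → i ≡ j
    f-injective {i} {j} eq = trans (sym (back i)) (trans
      (cong component (trans (lookup-index (mem i)) (trans (cong (lookup R) eq) (sym (lookup-index (mem j))))))
      (back j))
      where
      back : ∀ i → component (l (representative i)) ≡ i
      back i = trans (component-l _) (component-representative i)

    g-injective : ∀ {i j} → g i ≡ g j → i ≡ j
    g-injective {i} {j} eq = lookup-injective (Unique.filter⁺ fixed? un)
      (trans (sym (fix i)) (trans (l-star (component-connected eq)) (fix j)))
      where
      fix : ∀ i → l (lookup R i) ≡ lookup R i
      fix i = proj₂ (∈-filter⁻ fixed? {xs = vs} (∈-lookup {xs = R} i))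

-- 2-factors of a cubic graph as complements of perfect matchings

third : ∀ {A : Set} {xs : List A} {a b} → Unique xs → length xs ≡ 3 → a ≢ b → a ∈ xs → b ∈ xs →
        ∃ λ c → c ∈ xs × c ≢ a × c ≢ b × All (λ x → x ≢ c → x ≡ a ⊎ x ≡ b) xs
third {A} {p ∷ q ∷ r ∷ []} ((p≢q ∷ p≢r ∷ []) ∷ (q≢r ∷ []) ∷ [] ∷ []) _ = go
  where
  skip : ∀ {x a b : A} → x ≢ x → x ≡ a ⊎ x ≡ b
  skip n = contradiction refl n
  xs = p ∷ q ∷ r ∷ []
  go : ∀ {a b} → a ≢ b → a ∈ xs → b ∈ xs →
       ∃ λ c → c ∈ xs × c ≢ a × c ≢ b × All (λ x → x ≢ c → x ≡ a ⊎ x ≡ b) xs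
  go a≢b (here refl) (here refl) = contradiction refl a≢b
  go a≢b (here refl) (there (here refl)) =
    r , there (there (here refl)) , ≢-sym p≢r , ≢-sym q≢r , (λ _ → inj₁ refl) ∷ (λ _ → inj₂ refl) ∷ skip ∷ []
  go a≢b (here refl) (there (there (here refl))) =
    q , there (here refl) , ≢-sym p≢q , q≢r , (λ _ → inj₁ refl) ∷ skip ∷ (λ _ → inj₂ refl) ∷ []
  go a≢b (there (here refl)) (here refl) =
    r , there (there (here refl)) , ≢-sym q≢r , ≢-sym p≢r , (λ _ → inj₂ refl) ∷ (λ _ → inj₁ refl) ∷ skip ∷ []
  go a≢b (there (here refl)) (there (here refl)) = contradiction refl a≢b
  go a≢b (there (here refl)) (there (there (here refl))) =
    p , here refl , p≢q , p≢r , skip ∷ (λ _ → inj₁ refl) ∷ (λ _ → inj₂ refl) ∷ []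
  go a≢b (there (there (here refl))) (here refl) =
    q , there (here refl) , q≢r , ≢-sym p≢q , (λ _ → inj₂ refl) ∷ skip ∷ (λ _ → inj₁ refl) ∷ []
  go a≢b (there (there (here refl))) (there (here refl)) =
    p , here refl , p≢r , p≢q , skip ∷ (λ _ → inj₂ refl) ∷ (λ _ → inj₁ refl) ∷ []
  go a≢b (there (there (here refl))) (there (there (here refl))) = contradiction refl a≢b

module Enumeration (G : Graph) (_≟_ : DecidableEquality (Graph.Vertex G)) where
  open Graph G
  open DecMembership _≟_ using (_∈?_; _∉?_)
  open Labelling _≟_

  vertices : List Vertex
  vertices = map (Inverse.from (proj₂ finite)) (allFin (proj₁ finite))

  neighbours : Vertex → List Vertex
  neighbours v = filter (adj? v) vertices

  star : Vertex → Vertex × List Vertex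
  star v = v , neighbours v

  keptEdges : Vertex × List Vertex → Vertex → List (Vertex × Vertex)
  keptEdges (b , ns) w = map (b ,_) (filter (λ u → ¬? (u ≟ w)) ns)

  -- All ways to choose distinct partners outside `used` for the centres of some stars,
  -- each recorded as the list of remaining edges of these stars.
  -- (Passing stars instead of vertices makes evaluation compute each neighbourhood once.)
  complements : List (Vertex × List Vertex) → List Vertex → List (List (Vertex × Vertex))
  complements []             used = [] ∷ []
  complements (s@(_ , ns) ∷ ss) used =
    concatMap (λ w → map (keptEdges s w ++_) (complements ss (w ∷ used)))
              (filter (_∉? used) ns)

  complement : (Vertex → Vertex) → List Vertex → List (Vertex × Vertex)
  complement m []       = []
  complement m (b ∷ bs) = keptEdges (star b) (m b) ++ complement m bs

  -- At every centre `b` the branch that picks `m b` is open, because injectivity keeps `m b` away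
  -- from the partners picked before.
  ∈-complements : ∀ {m : Vertex → Vertex} → (∀ b → m b ∈ neighbours b) → (∀ {a b} → m a ≡ m b → a ≡ b) →
                  ∀ {bs} used → Unique bs → (∀ {b} → b ∈ bs → m b ∉ used) →
                  complement m bs ∈ complements (map star bs) used
  ∈-complements nb inj {[]}     used un        fresh = here refl
  ∈-complements {m} nb inj {b ∷ bs} used un@(_ ∷ un′) fresh =
    ∈-concatMap⁺ (λ w → map (keptEdges (star b) w ++_) (complements (map star bs) (w ∷ used)))
      (Any.map (λ { refl → ∈-map⁺ (keptEdges (star b) (m b) ++_) (∈-complements nb inj (m b ∷ used) un′ fresh′) })
      (∈-filter⁺ (_∉? used) (nb b) (fresh (here refl))))
    where
    fresh′ : ∀ {c} → c ∈ bs → m c ∉ m b ∷ used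
    fresh′ p (here eq) = unique-head un (subst (_∈ bs) (inj eq) p)
    fresh′ p (there q) = fresh (there p) q

  module _ (cubic : ∀ v → length (neighbours v) ≡ 3) (F : TwoFactor G) where
    open TwoFactor F

    vertices-unique : Unique vertices
    vertices-unique = Unique.map⁺ injective (Unique.allFin⁺ _)
      where
      open Inverse (proj₂ finite) using (strictlyInverseˡ) renaming (to to φ)
      injective : ∀ {x y} → _ ≡ _ → x ≡ y
      injective eq = trans (sym (strictlyInverseˡ _)) (trans (cong φ eq) (strictlyInverseˡ _))

    ∈-vertices : ∀ v → v ∈ vertices
    ∈-vertices v = subst (_∈ vertices) (strictlyInverseʳ v) (∈-map⁺ _ (∈-allFin _))
      where open Inverse (proj₂ finite)

    ∈-neighbours : ∀ {u v} → Adj u v → v ∈ neighbours u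
    ∈-neighbours a = ∈-filter⁺ (adj? _) (∈-vertices _) a

    -- The 2-factor uses two of the three neighbours of `v`; `third` supplies the one left over, the
    -- partner of `v` in the matching.
    missing : ∀ v → ∃ λ w → w ∈ neighbours v × ¬ E v w × (∀ {u} → u ∈ neighbours v → u ≢ w → E v u)
    missing v with a ∷ b ∷ [] , (a≢b ∷ []) ∷ _ , mem ← two-valent v
      with c , c∈ , c≢a , c≢b , rest ← third (Unique.filter⁺ (adj? v) vertices-unique) (cubic v) a≢b
                                         (∈-neighbours (E⊆Adj (from (mem a) (here refl))))
                                         (∈-neighbours (E⊆Adj (from (mem b) (there (here refl)))))
      = c , c∈
      , (λ e → avoid (to (mem c) e))
      , λ {u} p q → from (mem u) ([ here , (λ eq → there (here eq)) ]′ (All.lookup rest p q))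
      where
      avoid : c Vec.∈ a ∷ b ∷ [] → ⊥
      avoid (here eq)         = c≢a eq
      avoid (there (here eq)) = c≢b eq

    partner : Vertex → Vertex
    partner v = proj₁ (missing v)

    partner-neighbour : ∀ v → partner v ∈ neighbours v
    partner-neighbour v = proj₁ (proj₂ (missing v))

    partner-unkept : ∀ v → ¬ E v (partner v)
    partner-unkept v = proj₁ (proj₂ (proj₂ (missing v)))

    kept : ∀ {u v} → v ∈ neighbours u → v ≢ partner u → E u v
    kept = proj₂ (proj₂ (proj₂ (missing _)))

    -- Otherwise the edge from `partner v` back to `v` would be kept, although `v` does not keep it.
    partner-involutive : ∀ v → partner (partner v) ≡ v
    partner-involutive v = sym (decidable-stable (v ≟ partner (partner v)) λ v≢ →
      partner-unkept v (E-sym (kept (∈-neighbours (adj-sym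
        (proj₂ (∈-filter⁻ (adj? v) {xs = vertices} (partner-neighbour v))))) v≢)))

    partner-injective : ∀ {u v} → partner u ≡ partner v → u ≡ v
    partner-injective {u} {v} eq = trans (sym (partner-involutive u)) (trans (cong partner eq) (partner-involutive v))

    complement-sound : ∀ bs → All (λ e → E (proj₁ e) (proj₂ e)) (complement partner bs)
    complement-sound []       = []
    complement-sound (b ∷ bs) = All.++⁺
      (All.map⁺ (All.tabulate λ p → let q , r = ∈-filter⁻ (λ u → ¬? (u ≟ partner b)) {xs = neighbours b} p in kept q r))
      (complement-sound bs)

    complement-complete : ∀ {bs u v} → u ∈ bs → E u v → (u , v) ∈ complement partner bs
    complement-complete {b ∷ bs} (here refl) e = ∈-++⁺ˡ (∈-map⁺ (b ,_)
      (∈-filter⁺ (λ u → ¬? (u ≟ partner b)) (∈-neighbours (E⊆Adj e)) λ { refl → partner-unkept b e }))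
    complement-complete {b ∷ bs} (there p) e = ∈-++⁺ʳ (keptEdges (star b) (partner b)) (complement-complete p e)

    -- When `bs` meets every edge, the edges kept at `bs` are the whole 2-factor. In a bipartite
    -- graph the search can therefore be confined to one colour class.
    circuits-parity : ∀ {bs r k} → Unique bs → (∀ {u v} → Adj u v → u ∈ bs ⊎ v ∈ bs) →
      All (λ es → components vertices es % 2 ≡ r) (complements (map star bs) []) →
      IsDisjointUnionOfCircuits F k → k % 2 ≡ r
    circuits-parity {bs} un cover check D = trans
      (cong (_% 2) (circuits≡components _≟_ D vertices-unique ∈-vertices (complement-sound bs)
        λ e → Sum.map (λ p → complement-complete p e) (λ p → complement-complete p (E-sym e)) (cover (E⊆Adj e))))
      (All.lookup check (∈-complements partner-neighbour partner-injective [] un λ _ ()))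

-- The Heawood graph and the Pappus graph by evaluation

heawood-pseudoTwoFactorIsomorphic : PseudoTwoFactorIsomorphic heawood
heawood-pseudoTwoFactorIsomorphic F F′ k k′ D D′ = trans (odd F D) (sym (odd F′ D′))
  where
  open Enumeration heawood (Sum.≡-dec _≟ᶠ_ _≟ᶠ_)
  open Labelling (Sum.≡-dec (_≟ᶠ_ {7}) (_≟ᶠ_ {7}))
  points = map inj₁ (allFin 7)

  cubic : ∀ v → length (neighbours v) ≡ 3
  cubic (inj₁ p) = from-yes (all? (λ p → length (neighbours (inj₁ p)) ≟ⁿ 3)) p
  cubic (inj₂ l) = from-yes (all? (λ l → length (neighbours (inj₂ l)) ≟ⁿ 3)) l

  cover : ∀ {u v} → Graph.Adj heawood u v → u ∈ points ⊎ v ∈ points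
  cover {inj₁ p} _ = inj₁ (∈-map⁺ inj₁ (∈-allFin p))
  cover {inj₂ _} {inj₁ p} _ = inj₂ (∈-map⁺ inj₁ (∈-allFin p))

  odd : ∀ F {k} → IsDisjointUnionOfCircuits F k → k % 2 ≡ 1
  odd F = circuits-parity cubic F {points} (Unique.map⁺ inj₁-injective (Unique.allFin⁺ 7)) (λ {u} → cover {u})
    (from-yes (All.all? (λ es → components vertices es % 2 ≟ⁿ 1) (complements (map star points) [])))

pappus-pseudoTwoFactorIsomorphic : PseudoTwoFactorIsomorphic pappus
pappus-pseudoTwoFactorIsomorphic F F′ k k′ D D′ = trans (odd F D) (sym (odd F′ D′))
  where
  open Enumeration pappus _≟ᶠ_
  open Labelling (_≟ᶠ_ {18})
  -- `i` stands for v_k with k = i + 1. Every edge joins an odd k to an even one, so the odd k form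
  -- a colour class.
  odd? = λ (i : Fin 18) → suc (toℕ i) % 2 ≟ⁿ 1
  odds = filter odd? (allFin 18)

  cubic : ∀ v → length (neighbours v) ≡ 3
  cubic = from-yes (all? (λ p → length (neighbours p) ≟ⁿ 3))

  arc : ∀ {u v} → (suc (toℕ u) , suc (toℕ v)) ∈ pappusEdges → u ∈ odds ⊎ v ∈ odds
  arc {u} {v} e = Sum.map (∈-filter⁺ odd? (∈-allFin u)) (∈-filter⁺ odd? (∈-allFin v))
    (All.lookup (from-yes (All.all? (λ e → proj₁ e % 2 ≟ⁿ 1 ⊎-dec proj₂ e % 2 ≟ⁿ 1) pappusEdges)) e)

  cover : ∀ {u v} → Graph.Adj pappus u v → u ∈ odds ⊎ v ∈ odds
  cover (fwd e) = arc e
  cover (bwd e) = swap (arc e)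

  odd : ∀ F {k} → IsDisjointUnionOfCircuits F k → k % 2 ≡ 1
  odd F = circuits-parity cubic F {odds} (Unique.filter⁺ odd? (Unique.allFin⁺ 18)) cover
    (from-yes (All.all? (λ es → components vertices es % 2 ≟ⁿ 1) (complements (map star odds) [])))

-- Running through Boben's list

open CyclicGraphs using (D-¬pseudo)
open SegmentGraphs using (T₁-¬pseudo; T₂-¬pseudo; T₃-¬pseudo)

theorem3p1 : BobenTheorem → (G : Graph) → (IrreducibleLeviGraph G × PseudoTwoFactorIsomorphic G) ⇔ (G ≅ heawood ⊎ G ≅ pappus)
theorem3p1 boben G = mk⇔
  (λ (irreducible , P) → classify P (to (boben G) irreducible))
  [ (λ iso → from (boben G) (inj₁ (7 , ≤-refl , iso)) ,
             pseudoTwoFactorIsomorphic-resp-≅ (≅-sym iso) heawood-pseudoTwoFactorIsomorphic)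
  , (λ iso → from (boben G) (inj₂ (inj₂ iso)) ,
             pseudoTwoFactorIsomorphic-resp-≅ (≅-sym iso) pappus-pseudoTwoFactorIsomorphic)
  ]′
  where
  excluded : ∀ {H} {A : Set} → PseudoTwoFactorIsomorphic G → ¬ PseudoTwoFactorIsomorphic H → G ≅ H → A
  excluded P ¬P iso = contradiction (pseudoTwoFactorIsomorphic-resp-≅ iso P) ¬P

  classify : PseudoTwoFactorIsomorphic G → InBobenList G → G ≅ heawood ⊎ G ≅ pappus
  classify P (inj₁ (n , 7≤n , iso)) with m≤n⇒∃[o]m+o≡n 7≤n
  -- Here `n` is 7 plus the remainder: 7 itself gives the Heawood graph, anything larger is of the
  -- form `8 + j`.
  ... | zero  , refl = inj₁ iso
  ... | suc j , refl = excluded P (D-¬pseudo j) iso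
  classify P (inj₂ (inj₁ (suc m , _ , inj₁ iso)))        = excluded P (T₁-¬pseudo m) iso
  classify P (inj₂ (inj₁ (suc m , _ , inj₂ (inj₁ iso)))) = excluded P (T₂-¬pseudo m) iso
  classify P (inj₂ (inj₁ (suc m , _ , inj₂ (inj₂ iso)))) = excluded P (T₃-¬pseudo m) iso
  classify P (inj₂ (inj₂ iso)) = inj₂ iso
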